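{- Let $\mathcal{A}$ be a finite abelian group admitting a perfect pairing $\langle\cdot,\cdot\rangle:\mathcal{A}\times\mathcal{A}\to\mathbb{Q}/\mathbb{Z}$, and write $\sim$ for equality up to multiplication by squares of nonzero rational numbers. (1) If $\langle\cdot,\cdot\rangle$ is antisymmetric, then $|\mathcal{A}|$ is either a square or twice a square, and it is a square if and only if $\mathcal{A}$ admits a perfect alternating pairing. Moreover, for every positive integer $e$, $|\mathcal{A}[e]|\sim|\mathcal{A}|$ if $e$ is even and $|\mathcal{A}[e]|\sim1$ if $e$ is odd. (2) If $F\in\mathrm{Aut}(\mathcal{A})$ and $\langle\cdot,\cdot\rangle$ is symmetric and $F$-invariant, then for every integer $f$, $|\mathcal{A}^{F^f}|\sim|\mathcal{A}^F|$ if $f$ is odd and $|\mathcal{A}^{F^f}|\sim|\mathcal{A}|$ if $f$ is even.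
   Context: $\mathcal{A}[e]$ is the $e$-torsion subgroup and $\mathcal{A}^{F^f}$ the subgroup fixed by $F^f$. -}

module Defs where

open import Level using (Level; _⊔_)
open import Data.Nat as ℕ using (ℕ; zero; suc; _%_)
open import Data.Integer as ℤ using (ℤ; +_; -[1+_]; ∣_∣)
open import Data.Rational as ℚ using (ℚ; 0ℚ)
open import Data.Fin using (Fin)
open import Data.Product using (Σ; ∃; _×_; _,_; proj₁)
open import Data.Sum using (_⊎_)
open import Function.Bundles using (Inverse)
open import Relation.Binary.Bundles using (Setoid)
open import Relation.Binary.PropositionalEquality as ≡ using (_≡_; _≢_)
open import Algebra.Bundles using (AbelianGroup)

HasSize : ∀ {c ℓ} → Setoid c ℓ → ℕ → Set (c ⊔ ℓ)
HasSize S m = Inverse (≡.setoid (Fin m)) S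

SubSetoid : ∀ {c ℓ p} (S : Setoid c ℓ) → (Setoid.Carrier S → Set p) → Setoid (c ⊔ p) ℓ
SubSetoid S P = record
  { Carrier = Σ (Setoid.Carrier S) P
  ; _≈_ = λ x y → Setoid._≈_ S (proj₁ x) (proj₁ y)
  ; isEquivalence = record
    { refl = Setoid.refl S
    ; sym = Setoid.sym S
    ; trans = Setoid.trans S
    }
  }

-- Q/Z : rationals with equality modulo integers.

_≈QZ_ : ℚ → ℚ → Set
x ≈QZ y = ℚ.denominator-1 (x ℚ.- y) ≡ 0     -- x - y ∈ ℤ

_∼_ : ℕ → ℕ → Set
a ∼ b = ∃ λ (q : ℚ) → q ≢ 0ℚ × ((+ a) ℚ./ 1 ≡ (q ℚ.* q) ℚ.* ((+ b) ℚ./ 1))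

IsSquare : ℕ → Set
IsSquare n = ∃ λ k → n ≡ k ℕ.* k

IsTwiceSquare : ℕ → Set
IsTwiceSquare n = ∃ λ k → n ≡ 2 ℕ.* (k ℕ.* k)

Evenℕ Oddℕ : ℕ → Set
Evenℕ n = n % 2 ≡ 0
Oddℕ n = n % 2 ≡ 1

Evenℤ Oddℤ : ℤ → Set
Evenℤ f = Evenℕ ∣ f ∣
Oddℤ f = Oddℕ ∣ f ∣

module _ {c ℓ} (A : AbelianGroup c ℓ) where
  open AbelianGroup A renaming (Carrier to G)

  record Pairing : Set (c ⊔ ℓ) where
    field
      ⟨_,_⟩ : G → G → ℚ
      cong  : ∀ {x x′ y y′} → x ≈ x′ → y ≈ y′ → ⟨ x , y ⟩ ≈QZ ⟨ x′ , y′ ⟩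
      linˡ  : ∀ x x′ y → ⟨ x ∙ x′ , y ⟩ ≈QZ (⟨ x , y ⟩ ℚ.+ ⟨ x′ , y ⟩)
      linʳ  : ∀ x y y′ → ⟨ x , y ∙ y′ ⟩ ≈QZ (⟨ x , y ⟩ ℚ.+ ⟨ x , y′ ⟩)

  record Character : Set (c ⊔ ℓ) where
    field
      χ     : G → ℚ
      cong  : ∀ {x y} → x ≈ y → χ x ≈QZ χ y
      hom   : ∀ x y → χ (x ∙ y) ≈QZ (χ x ℚ.+ χ y)

  record Perfect (P : Pairing) : Set (c ⊔ ℓ) where
    open Pairing P
    field
      injˡ  : ∀ a b → (∀ x → ⟨ a , x ⟩ ≈QZ ⟨ b , x ⟩) → a ≈ b
      surjˡ : (ψ : Character) → ∃ λ a → ∀ x → ⟨ a , x ⟩ ≈QZ Character.χ ψ x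
      injʳ  : ∀ a b → (∀ x → ⟨ x , a ⟩ ≈QZ ⟨ x , b ⟩) → a ≈ b
      surjʳ : (ψ : Character) → ∃ λ a → ∀ x → ⟨ x , a ⟩ ≈QZ Character.χ ψ x

  Antisymmetric : Pairing → Set c
  Antisymmetric P = ∀ x y → ⟨ x , y ⟩ ≈QZ (ℚ.- ⟨ y , x ⟩)
    where open Pairing P

  Alternating : Pairing → Set c
  Alternating P = ∀ x → ⟨ x , x ⟩ ≈QZ 0ℚ
    where open Pairing P

  SymmetricP : Pairing → Set c
  SymmetricP P = ∀ x y → ⟨ x , y ⟩ ≈QZ ⟨ y , x ⟩
    where open Pairing P

  infixr 8 _·_
  _·_ : ℕ → G → G
  zero · x = ε
  suc n · x = x ∙ (n · x)

  Torsion : ℕ → Setoid (c ⊔ ℓ) ℓ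
  Torsion e = SubSetoid setoid (λ x → e · x ≈ ε)

  record Automorphism : Set (c ⊔ ℓ) where
    field
      F       : G → G
      F⁻¹     : G → G
      F-cong  : ∀ {x y} → x ≈ y → F x ≈ F y
      F⁻¹-cong : ∀ {x y} → x ≈ y → F⁻¹ x ≈ F⁻¹ y
      F-hom   : ∀ x y → F (x ∙ y) ≈ F x ∙ F y
      F∘F⁻¹   : ∀ x → F (F⁻¹ x) ≈ x
      F⁻¹∘F   : ∀ x → F⁻¹ (F x) ≈ x

  Invariant : Automorphism → Pairing → Set c
  Invariant φ P = ∀ x y → ⟨ F x , F y ⟩ ≈QZ ⟨ x , y ⟩
    where open Pairing P
          open Automorphism φ

  iter : (G → G) → ℕ → G → G
  iter h zero x = x
  iter h (suc n) x = h (iter h n x)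

  pow : Automorphism → ℤ → G → G
  pow φ (+ n) = iter (Automorphism.F φ) n
  pow φ -[1+ n ] = iter (Automorphism.F⁻¹ φ) (suc n)

  Fixed : Automorphism → ℤ → Setoid (c ⊔ ℓ) ℓ
  Fixed φ f = SubSetoid setoid (λ x → pow φ f x ≈ x)

{-# OPTIONS --safe #-}

-- Everything reduces to one fact: if b is an alternating form on a finite abelian group A, with
-- values in a cyclic group of order N, then |A| = |Rad b| k² for some k.  Choose x, y for which
-- b x y = a/N with a > 0 minimal; by Euclidean division a divides N and all values b x z and b z y,
-- so with d = N / a the subgroup x⊥ has index d in A, while its radical Rad b + ⟨x⟩ is d times
-- larger than Rad b.  Induction applies to x⊥.
--
-- For a perfect pairing and an endomorphism g with ⟨g x , x⟩ = 0 this gives |A| = |Ker g| k².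
-- * Antisymmetric case: q x = ⟨x , x⟩ is a character of order at most 2, say q = ⟨c , -⟩, and g
--   adds c to x whenever q x ≠ 0.  Its kernel is trivial if q c = 0 and is {0 , c} otherwise.
-- * Torsion: take g = e for even e; for odd e compare A[2e] with A[2].
-- * Isometries: take g = F^k − F^(−k), with kernel the fixed points of F^(2k).  For f = 2k + 1 also
--   take g = F^(k+1) + F^k − F^(−k) − F^(−k−1), with kernel K = Ker (F^f − 1)(F + 1).  Then F − 1
--   on A^(F^f) and F² − 1 on K have the same image, and kernels A^F and A^(F²).
module Submission where

open import Defs
open import Level using (Level; 0ℓ; _⊔_)
open import Data.Nat as ℕ using (ℕ; zero; suc; NonZero; _<_; _≤_; _>_)
import Data.Nat.Properties as ℕ
import Data.Nat.Coprimality as Coprimality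
open import Data.Nat.DivMod using (m≡m%n+[m/n]*n; m%n<n)
open import Data.Nat.Divisibility as ℕ∣ using (_∣_; divides)
open import Data.Nat.Induction using (<-wellFounded; Acc; acc)
open import Data.Nat.Primality using (euclidsLemma; prime[2])
open import Data.Nat.Tactic.RingSolver using (solve-∀)
open import Data.Fin using (Fin; zero; suc; toℕ; fromℕ<; combine; remQuot)
import Data.Fin.Properties as Fin
open import Data.Fin.Permutation using (↔⇒≡)
open import Data.Integer as ℤ using (ℤ; +_; -[1+_])
import Data.Integer.DivMod as ℤ
import Data.Integer.Properties as ℤ
import Data.Integer.Tactic.RingSolver as ℤSolver
open import Data.Rational as ℚ using (ℚ; mkℚ; 0ℚ; ½)
import Data.Rational.Properties as ℚ
open import Data.Rational.Solver using (module +-*-Solver)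
import Data.Rational.Unnormalised as ℚᵘ
import Data.Rational.Unnormalised.Properties as ℚᵘ
open import Data.Product using (Σ; ∃; _×_; _,_; proj₁; proj₂)
open import Data.Sum using (_⊎_; inj₁; inj₂; reduce)
open import Function.Base using (_∘_)
open import Function.Bundles using (Inverse; _⇔_; mk⇔)
import Function.Construct.Composition as Composition
import Function.Construct.Symmetry as Symmetry
open import Relation.Binary.Bundles using (Setoid)
open import Relation.Binary.PropositionalEquality as ≡ using (_≡_; _≢_)
open import Relation.Nullary using (¬_; Dec; yes; no; contradiction)
open import Relation.Nullary.Decidable using (map′; _×-dec_)
open import Algebra.Bundles using (AbelianGroup)
import Algebra.Properties.AbelianGroup as AbelianGroupProperties
import Algebra.Properties.CommutativeMonoid.Mult as Mult
open import Algebra.Properties.CommutativeSemigroup using (interchange)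
import Relation.Binary.Reasoning.Setoid as SetoidReasoning

private variable
  c ℓ c′ ℓ′ p : Level

-- Finite setoids

module _ {S : Setoid c ℓ} where
  open Setoid S

  size-bijection : ∀ {m} (f : Fin m → Carrier) → (∀ {i j} → f i ≈ f j → i ≡ j) →
                   (∀ s → ∃ λ i → f i ≈ s) → HasSize S m
  size-bijection f f-injective f-surjective = record
    { to        = f
    ; from      = λ s → proj₁ (f-surjective s)
    ; to-cong   = λ { ≡.refl → refl }
    ; from-cong = λ {s} {t} s≈t → f-injective
        (trans (proj₂ (f-surjective s)) (trans s≈t (sym (proj₂ (f-surjective t)))))
    ; inverse   = (λ { {s} ≡.refl → proj₂ (f-surjective s) })
                , (λ {i} {s} s≈fi → f-injective (trans (proj₂ (f-surjective s)) s≈fi))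
    }

  size-unique : ∀ {m n} → HasSize S m → HasSize S n → m ≡ n
  size-unique I J = ↔⇒≡ (Composition.inverse I (Symmetry.inverse J))

module Enumeration {S : Setoid c ℓ} {n : ℕ} (I : HasSize S n) where
  open Setoid S

  element : Fin n → Carrier
  element = Inverse.to I

  index : Carrier → Fin n
  index = Inverse.from I

  element-index : ∀ s → element (index s) ≈ s
  element-index = Inverse.strictlyInverseˡ I

  element-injective : ∀ {i j} → element i ≈ element j → i ≡ j
  element-injective {i} {j} eq =
    ≡.trans (≡.sym (Inverse.strictlyInverseʳ I i)) (Inverse.inverseʳ I eq)

  index-cong : ∀ {s t} → s ≈ t → index s ≡ index t
  index-cong = Inverse.from-cong I

  infix 4 _≈?_
  _≈?_ : ∀ s t → Dec (s ≈ t)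
  s ≈? t = map′ (λ eq → trans (sym (element-index s))
                          (trans (reflexive (≡.cong element eq)) (element-index t)))
                index-cong (index s Fin.≟ index t)

  any? : {P : Carrier → Set p} → (∀ {s t} → s ≈ t → P s → P t) → (∀ s → Dec (P s)) → Dec (∃ P)
  any? resp P? = map′ (λ { (i , Pi) → element i , Pi })
                      (λ { (s , Ps) → index s , resp (sym (element-index s)) Ps })
                      (Fin.any? (λ i → P? (element i)))

module _ {S : Setoid c ℓ} {T : Setoid c′ ℓ′} where
  private
    module S = Setoid S
    module T = Setoid T

  size-transport : ∀ {m} (f : S.Carrier → T.Carrier) →
                   (∀ {x y} → x S.≈ y → f x T.≈ f y) →
                   (∀ {x y} → f x T.≈ f y → x S.≈ y) →
                   (∀ t → ∃ λ s → f s T.≈ t) → HasSize S m → HasSize T m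
  size-transport f f-cong f-injective f-surjective I = size-bijection (λ i → f (element i))
    (λ eq → element-injective (f-injective eq))
    (λ t → let s , fs≈t = f-surjective t in
       index s , T.trans (f-cong (element-index s)) fs≈t)
    where open Enumeration I

size-⇔ : ∀ {c ℓ p q} {S : Setoid c ℓ} {P : Setoid.Carrier S → Set p} {Q : Setoid.Carrier S → Set q} {m : ℕ} →
         (∀ x → P x → Q x) → (∀ x → Q x → P x) →
         HasSize (SubSetoid S P) m → HasSize (SubSetoid S Q) m
size-⇔ {S = S} P⇒Q Q⇒P = size-transport (λ { (x , Px) → x , P⇒Q x Px }) (λ eq → eq) (λ eq → eq)
  (λ { (x , Qx) → (x , Q⇒P x Qx) , Setoid.refl S })

Fin-subset-size : ∀ n (P : Fin n → Set p) → (∀ i → Dec (P i)) →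
                  ∃ λ m → HasSize (SubSetoid (≡.setoid (Fin n)) P) m
Fin-subset-size zero P P? = 0 , size-bijection (λ ()) (λ { {()} }) (λ { (() , _) })
Fin-subset-size (suc n) P P? with Fin-subset-size n (P ∘ suc) (P? ∘ suc) | P? zero
... | m , I | yes P0 = suc m , size-bijection f f-injective f-surjective
  where
  open Enumeration I
  f : Fin (suc m) → Σ (Fin (suc n)) P
  f zero    = zero , P0
  f (suc i) = suc (proj₁ (element i)) , proj₂ (element i)
  f-injective : ∀ {i j} → proj₁ (f i) ≡ proj₁ (f j) → i ≡ j
  f-injective {zero}  {zero}  eq = ≡.refl
  f-injective {suc i} {suc j} eq = ≡.cong suc (element-injective (Fin.suc-injective eq))
  f-surjective : ∀ s → ∃ λ i → proj₁ (f i) ≡ proj₁ s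
  f-surjective (zero  , _)  = zero , ≡.refl
  f-surjective (suc s , Ps) = suc (index (s , Ps)) , ≡.cong suc (element-index (s , Ps))
... | m , I | no ¬P0 = m , size-bijection (λ i → suc (proj₁ (element i)) , proj₂ (element i))
  (λ eq → element-injective (Fin.suc-injective eq))
  (λ { (zero  , P0) → contradiction P0 ¬P0
     ; (suc s , Ps) → index (s , Ps) , ≡.cong suc (element-index (s , Ps)) })
  where open Enumeration I

-- Supplies the orders of auxiliary subgroups and images, such as `x⊥` or A[2], for which no
-- enumeration is given; deciding `P` on the representatives makes the counting possible.
subset-size : ∀ {c ℓ p} {S : Setoid c ℓ} {P : Setoid.Carrier S → Set p} {n : ℕ} → HasSize S n →
              (∀ {s t} → Setoid._≈_ S s t → P s → P t) → (∀ s → Dec (P s)) →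
              ∃ λ m → HasSize (SubSetoid S P) m
subset-size {S = S} {P} {n} I resp P? =
  let m , J = Fin-subset-size n (λ i → P (element i)) (λ i → P? (element i)) in
  m , size-transport (λ { (i , Pi) → element i , Pi }) (λ { ≡.refl → Setoid.refl S }) element-injective
        (λ { (s , Ps) → (index s , resp (Setoid.sym S (element-index s)) Ps) , element-index s }) J
  where open Enumeration I

-- Homomorphisms and subgroups

×-zeroʳ : (G : AbelianGroup c ℓ) → let open AbelianGroup G; open Mult commutativeMonoid using () renaming (_×_ to _⋆_) in
          ∀ n {x} → x ≈ ε → n ⋆ x ≈ ε
×-zeroʳ G zero    x≈ε = AbelianGroup.refl G
×-zeroʳ G (suc n) x≈ε = trans (∙-cong x≈ε (×-zeroʳ G n x≈ε)) (identityˡ ε)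
  where open AbelianGroup G

record IsAdditive (G : AbelianGroup c ℓ) (H : AbelianGroup c′ ℓ′)
                  (h : AbelianGroup.Carrier G → AbelianGroup.Carrier H) : Set (c ⊔ ℓ ⊔ ℓ′) where
  private
    module G = AbelianGroup G
    module H = AbelianGroup H
    module HP = AbelianGroupProperties H
    module G× = Mult G.commutativeMonoid
    module H× = Mult H.commutativeMonoid
  field
    cong : ∀ {x y} → x G.≈ y → h x H.≈ h y
    homo : ∀ x y → h (x G.∙ y) H.≈ h x H.∙ h y

  ε-homo : h G.ε H.≈ H.ε
  ε-homo = HP.identityˡ-unique _ _ (H.trans (H.sym (homo G.ε G.ε)) (cong (G.identityˡ G.ε)))

  ⁻¹-homo : ∀ x → h (x G.⁻¹) H.≈ h x H.⁻¹
  ⁻¹-homo x = HP.inverseˡ-unique _ _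
    (H.trans (H.sym (homo (x G.⁻¹) x)) (H.trans (cong (G.inverseˡ x)) ε-homo))

  -‿homo : ∀ x y → h (x G.∙ y G.⁻¹) H.≈ h x H.∙ h y H.⁻¹
  -‿homo x y = H.trans (homo x (y G.⁻¹)) (H.∙-congˡ (⁻¹-homo y))

  ×-homo : ∀ n x → h (n G×.× x) H.≈ n H×.× h x
  ×-homo zero    x = ε-homo
  ×-homo (suc n) x = H.trans (homo x (n G×.× x)) (H.∙-congˡ (×-homo n x))

module _ {G : AbelianGroup c ℓ} {H : AbelianGroup c′ ℓ′} where
  private
    module G = AbelianGroup G
    module H = AbelianGroup H
    module HP = AbelianGroupProperties H

  additive-∙ : ∀ {f h} → IsAdditive G H f → IsAdditive G H h → IsAdditive G H (λ x → f x H.∙ h x)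
  additive-∙ {f} {h} f+ h+ = record
    { cong = λ eq → H.∙-cong (F.cong eq) (H′.cong eq)
    ; homo = λ x y → H.trans (H.∙-cong (F.homo x y) (H′.homo x y)) (interchange H.commutativeSemigroup _ _ _ _)
    }
    where
    module F = IsAdditive f+
    module H′ = IsAdditive h+

  additive-⁻¹ : ∀ {f} → IsAdditive G H f → IsAdditive G H (λ x → f x H.⁻¹)
  additive-⁻¹ {f} f+ = record
    { cong = λ eq → H.⁻¹-cong (F.cong eq)
    ; homo = λ x y → H.trans (H.⁻¹-cong (F.homo x y)) (H.sym (HP.⁻¹-∙-comm (f x) (f y)))
    }
    where module F = IsAdditive f+

additive-∘ : ∀ {c₁ ℓ₁ c₂ ℓ₂ c₃ ℓ₃} {G : AbelianGroup c₁ ℓ₁} {H : AbelianGroup c₂ ℓ₂} {K : AbelianGroup c₃ ℓ₃} {f h} →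
             IsAdditive H K f → IsAdditive G H h → IsAdditive G K (λ x → f (h x))
additive-∘ {K = K} f+ h+ = record
  { cong = λ eq → F.cong (H.cong eq)
  ; homo = λ x y → AbelianGroup.trans K (F.cong (H.homo x y)) (F.homo _ _)
  }
  where
  module F = IsAdditive f+
  module H = IsAdditive h+

additive-id : {G : AbelianGroup c ℓ} → IsAdditive G G (λ x → x)
additive-id {G = G} = record { cong = λ eq → eq ; homo = λ _ _ → AbelianGroup.refl G }

record IsSubgroup (G : AbelianGroup c ℓ) (P : AbelianGroup.Carrier G → Set p) : Set (c ⊔ p) where
  open AbelianGroup G
  field
    ∙-closed  : ∀ {x y} → P x → P y → P (x ∙ y)
    ε-closed  : P ε
    ⁻¹-closed : ∀ {x} → P x → P (x ⁻¹)

subgroup : (G : AbelianGroup c ℓ) {P : AbelianGroup.Carrier G → Set p} → IsSubgroup G P → AbelianGroup (c ⊔ p) ℓ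
subgroup G {P} H = record
  { Carrier = Σ Carrier P
  ; _≈_     = λ x y → proj₁ x ≈ proj₁ y
  ; _∙_     = λ x y → proj₁ x ∙ proj₁ y , ∙-closed (proj₂ x) (proj₂ y)
  ; ε       = ε , ε-closed
  ; _⁻¹     = λ x → proj₁ x ⁻¹ , ⁻¹-closed (proj₂ x)
  ; isAbelianGroup = record
    { isGroup = record
      { isMonoid = record
        { isSemigroup = record
          { isMagma = record
            { isEquivalence = Setoid.isEquivalence (SubSetoid setoid P)
            ; ∙-cong = ∙-cong
            }
          ; assoc = λ x y z → assoc (proj₁ x) (proj₁ y) (proj₁ z)
          }
        ; identity = (λ x → identityˡ (proj₁ x)) , (λ x → identityʳ (proj₁ x))
        }
      ; inverse = (λ x → inverseˡ (proj₁ x)) , (λ x → inverseʳ (proj₁ x))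
      ; ⁻¹-cong = ⁻¹-cong
      }
    ; comm = λ x y → comm (proj₁ x) (proj₁ y)
    }
  }
  where
  open AbelianGroup G
  open IsSubgroup H

additive-proj₁ : {G : AbelianGroup c ℓ} {P : AbelianGroup.Carrier G → Set p} (S : IsSubgroup G P) →
                 IsAdditive (subgroup G S) G proj₁
additive-proj₁ {G = G} S = record { cong = λ eq → eq ; homo = λ _ _ → AbelianGroup.refl G }

module _ (G : AbelianGroup c ℓ) (H : AbelianGroup c′ ℓ′) where
  private
    module G = AbelianGroup G
    module H = AbelianGroup H
    module GP = AbelianGroupProperties G
    module HP = AbelianGroupProperties H

  Ker : (G.Carrier → H.Carrier) → Setoid (c ⊔ ℓ′) ℓ
  Ker h = SubSetoid G.setoid (λ x → h x H.≈ H.ε)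

  Im : (G.Carrier → H.Carrier) → Setoid (c ⊔ c′ ⊔ ℓ′) ℓ′
  Im h = SubSetoid H.setoid (λ u → ∃ λ x → h x H.≈ u)

  module _ {h} (h+ : IsAdditive G H h) where
    open IsAdditive h+

    ker-isSubgroup : IsSubgroup G (λ x → h x H.≈ H.ε)
    ker-isSubgroup = record
      { ∙-closed  = λ {x} {y} hx≈ε hy≈ε →
          H.trans (homo x y) (H.trans (H.∙-cong hx≈ε hy≈ε) (H.identityˡ H.ε))
      ; ε-closed  = ε-homo
      ; ⁻¹-closed = λ {x} hx≈ε → H.trans (⁻¹-homo x) (H.trans (H.⁻¹-cong hx≈ε) HP.ε⁻¹≈ε)
      }

    ker-diff : ∀ {x y} → h x H.≈ h y → h (x G.∙ y G.⁻¹) H.≈ H.ε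
    ker-diff {x} {y} hx≈hy = H.trans (-‿homo x y) (HP.x≈y⇒x∙y⁻¹≈ε hx≈hy)

    -- Fix a preimage of every element of the image. Each element of `G` is then uniquely a kernel
    -- element plus one of these preimages, and `combine` packs the two indices into one.
    size-ker-im : ∀ {k d} → HasSize (Ker h) k → HasSize (Im h) d → HasSize G.setoid (k ℕ.* d)
    size-ker-im {k} {d} I J = size-bijection (λ i → f (remQuot d i)) f-injective f-surjective
      where
      module I = Enumeration I
      module J = Enumeration J

      lift : Fin d → G.Carrier
      lift j = proj₁ (proj₂ (J.element j))

      h-lift : ∀ j → h (lift j) H.≈ proj₁ (J.element j)
      h-lift j = proj₂ (proj₂ (J.element j))

      f : Fin k × Fin d → G.Carrier
      f (i , j) = proj₁ (I.element i) G.∙ lift j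

      h-f : ∀ i j → h (f (i , j)) H.≈ proj₁ (J.element j)
      h-f i j = H.trans (homo _ _)
        (H.trans (H.∙-cong (proj₂ (I.element i)) (h-lift j)) (H.identityˡ _))

      f-injective′ : ∀ i j i′ j′ → f (i , j) G.≈ f (i′ , j′) → (i , j) ≡ (i′ , j′)
      -- Applying `h` removes the kernel parts, so `j` and `j′` agree; the common lift then cancels.
      f-injective′ i j i′ j′ eq with J.element-injective {j} {j′}
        (H.trans (H.sym (h-f i j)) (H.trans (cong eq) (h-f i′ j′)))
      ... | ≡.refl = ≡.cong (_, j) (I.element-injective (GP.∙-cancelʳ _ _ _ eq))

      f-injective : ∀ {i j} → f (remQuot d i) G.≈ f (remQuot d j) → i ≡ j
      f-injective {i} {j} eq = ≡.trans (≡.sym (Fin.combine-remQuot {k} d i))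
        (≡.trans (≡.cong (λ ij → combine (proj₁ ij) (proj₂ ij)) (f-injective′ _ _ _ _ eq))
                 (Fin.combine-remQuot {k} d j))

      f-surjective : ∀ x → ∃ λ i → f (remQuot d i) G.≈ x
      f-surjective x = combine i j , (begin
        f (remQuot d (combine i j))  ≡⟨ ≡.cong f (Fin.remQuot-combine i j) ⟩
        f (i , j)                    ≈⟨ G.∙-congʳ (I.element-index y) ⟩
        x G.∙ lift j G.⁻¹ G.∙ lift j ≈⟨ GP.//-rightDividesˡ (lift j) x ⟩
        x                            ∎)
        where
        open SetoidReasoning G.setoid
        j : Fin d
        j = J.index (h x , x , H.refl)
        y : Setoid.Carrier (Ker h)
        y = x G.∙ lift j G.⁻¹ ,
            ker-diff (H.sym (H.trans (h-lift j) (J.element-index (h x , x , H.refl))))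
        i : Fin k
        i = I.index y

-- Minimal values and cyclic images of homomorphisms

least : {P : ℕ → Set p} → (∀ i → Dec (P i)) → ∀ n → P n → ∃ λ a → P a × (∀ i → i < a → ¬ P i)
least {P = P} P? n Pn = go n (<-wellFounded n) Pn
  where
  go : ∀ n → Acc _<_ n → P n → ∃ λ a → P a × (∀ i → i < a → ¬ P i)
  go n (acc rec) Pn with ℕ.anyUpTo? P? n
  ... | yes (i , i<n , Pi) = go i (rec i<n) Pi
  ... | no  none           = n , Pn , λ i i<n Pi → none (i , i<n , Pi)

module _ (G : AbelianGroup c ℓ) (H : AbelianGroup c′ ℓ′) where
  private
    module G = AbelianGroup G
    module H = AbelianGroup H
    module HP = AbelianGroupProperties H
    module G× = Mult G.commutativeMonoid
  open Mult H.commutativeMonoid using () renaming (_×_ to _⋆_)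
  private module H× = Mult H.commutativeMonoid

  module _ {h} (h+ : IsAdditive G H h) (γ : H.Carrier) (y : G.Carrier) where
    open IsAdditive h+

    -- Euclidean division: subtracting `q` times `y` from `z` makes `w % a` the coefficient of a
    -- value of `h`, and by minimality of `a` it can only be 0.
    least-multiple-divides : ∀ a .{{_ : NonZero a}} → h y H.≈ a ⋆ γ →
      (∀ i → 0 < i → i < a → ∀ z → ¬ (h z H.≈ i ⋆ γ)) → ∀ w z → h z H.≈ w ⋆ γ → a ∣ w
    least-multiple-divides a hy≈aγ minimal w z hz≈wγ = go (w ℕ.% a) ≡.refl
      where
      q = w ℕ./ a
      remainder : h (z G.∙ (q G×.× y) G.⁻¹) H.≈ (w ℕ.% a) ⋆ γ
      remainder = begin
        h (z G.∙ (q G×.× y) G.⁻¹)              ≈⟨ -‿homo z (q G×.× y) ⟩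
        h z H.∙ h (q G×.× y) H.⁻¹               ≈⟨ H.∙-cong hz≈wγ (H.⁻¹-cong (begin
            h (q G×.× y)      ≈⟨ ×-homo q y ⟩
            q ⋆ h y           ≈⟨ H×.×-congʳ q hy≈aγ ⟩
            q ⋆ (a ⋆ γ)       ≈⟨ H×.×-assocˡ γ q a ⟩
            (q ℕ.* a) ⋆ γ     ∎)) ⟩
        w ⋆ γ H.∙ ((q ℕ.* a) ⋆ γ) H.⁻¹
          ≈⟨ H.∙-congʳ (H.trans (H×.×-congˡ (m≡m%n+[m/n]*n w a)) (H×.×-homo-+ γ (w ℕ.% a) (q ℕ.* a))) ⟩
        (w ℕ.% a) ⋆ γ H.∙ (q ℕ.* a) ⋆ γ H.∙ ((q ℕ.* a) ⋆ γ) H.⁻¹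
          ≈⟨ HP.//-rightDividesʳ _ _ ⟩
        (w ℕ.% a) ⋆ γ                           ∎
        where open SetoidReasoning H.setoid
      go : ∀ r → w ℕ.% a ≡ r → a ∣ w
      go zero    eq = ℕ∣.m%n≡0⇒n∣m w a eq
      go (suc r) eq = contradiction remainder
        (minimal (w ℕ.% a) (≡.subst (0 <_) (≡.sym eq) ℕ.z<s) (m%n<n w a) _)

    -- The order conditions make the multiples of `γ` by 0, ..., d - 1 distinct, and reducing a
    -- coefficient modulo `d` does not change the multiple.
    size-cyclic-image : ∀ d .{{_ : NonZero d}} → h y H.≈ γ → (∀ z → ∃ λ i → h z H.≈ i ⋆ γ) →
                        d ⋆ γ H.≈ H.ε → (∀ i → i ⋆ γ H.≈ H.ε → d ∣ i) → HasSize (Im G H h) d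
    size-cyclic-image d hy≈γ generated dγ≈ε order = size-bijection
      (λ i → toℕ i ⋆ γ , toℕ i G×.× y , H.trans (×-homo (toℕ i) y) (H×.×-congʳ (toℕ i) hy≈γ))
      (λ {i} {j} → f-injective i j) f-surjective
      where
      open SetoidReasoning H.setoid

      -- The difference `j ∸ i` kills `γ`, so `d` divides it; being below `d`, it is 0.
      diff : ∀ i j → i ≤ j → j < d → i ⋆ γ H.≈ j ⋆ γ → i ≡ j
      diff i j i≤j j<d eq = ℕ.≤-antisym i≤j (ℕ.m∸n≡0⇒m≤n (go (j ℕ.∸ i) ≡.refl))
        where
        [j∸i]γ≈ε : (j ℕ.∸ i) ⋆ γ H.≈ H.ε
        [j∸i]γ≈ε = HP.identityˡ-unique _ (i ⋆ γ) (begin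
          (j ℕ.∸ i) ⋆ γ H.∙ i ⋆ γ   ≈⟨ H×.×-homo-+ γ (j ℕ.∸ i) i ⟨
          (j ℕ.∸ i ℕ.+ i) ⋆ γ       ≈⟨ H×.×-congˡ (ℕ.m∸n+n≡m i≤j) ⟩
          j ⋆ γ                     ≈⟨ eq ⟨
          i ⋆ γ                     ∎)
        go : ∀ k → j ℕ.∸ i ≡ k → j ℕ.∸ i ≡ 0
        go zero    eq = eq
        go (suc k) eq = contradiction
          (ℕ∣.∣⇒≤ {{≡.subst NonZero (≡.sym eq) _}} (order (j ℕ.∸ i) [j∸i]γ≈ε))
          (ℕ.<⇒≱ (ℕ.≤-<-trans (ℕ.m∸n≤m j i) j<d))

      f-injective : ∀ (i j : Fin d) → toℕ i ⋆ γ H.≈ toℕ j ⋆ γ → i ≡ j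
      f-injective i j eq with ℕ.≤-total (toℕ i) (toℕ j)
      ... | inj₁ i≤j = Fin.toℕ-injective (diff _ _ i≤j (Fin.toℕ<n j) eq)
      ... | inj₂ j≤i = Fin.toℕ-injective (≡.sym (diff _ _ j≤i (Fin.toℕ<n i) (H.sym eq)))

      %-multiple : ∀ i → (i ℕ.% d) ⋆ γ H.≈ i ⋆ γ
      %-multiple i = H.sym (begin
        i ⋆ γ                                     ≈⟨ H×.×-congˡ (m≡m%n+[m/n]*n i d) ⟩
        (i ℕ.% d ℕ.+ i ℕ./ d ℕ.* d) ⋆ γ           ≈⟨ H×.×-homo-+ γ (i ℕ.% d) _ ⟩
        (i ℕ.% d) ⋆ γ H.∙ (i ℕ./ d ℕ.* d) ⋆ γ     ≈⟨ H.∙-congˡ (H×.×-assocˡ γ (i ℕ./ d) d) ⟨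
        (i ℕ.% d) ⋆ γ H.∙ (i ℕ./ d) ⋆ (d ⋆ γ)     ≈⟨ H.∙-congˡ (×-zeroʳ H (i ℕ./ d) dγ≈ε) ⟩
        (i ℕ.% d) ⋆ γ H.∙ H.ε                     ≈⟨ H.identityʳ _ ⟩
        (i ℕ.% d) ⋆ γ                             ∎)

      f-surjective : ∀ (u : Setoid.Carrier (Im G H h)) → ∃ λ (i : Fin d) → toℕ i ⋆ γ H.≈ proj₁ u
      f-surjective (u , z , hz≈u) = let i , hz≈iγ = generated z in
        fromℕ< (m%n<n i d) , (begin
          toℕ (fromℕ< (m%n<n i d)) ⋆ γ  ≈⟨ H×.×-congˡ (Fin.toℕ-fromℕ< (m%n<n i d)) ⟩
          (i ℕ.% d) ⋆ γ                 ≈⟨ %-multiple i ⟩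
          i ⋆ γ                         ≈⟨ hz≈iγ ⟨
          h z                           ≈⟨ hz≈u ⟩
          u                             ∎)

-- Alternating forms

record IsAlternatingForm (A : AbelianGroup c ℓ) (V : AbelianGroup c′ ℓ′)
         (b : AbelianGroup.Carrier A → AbelianGroup.Carrier A → AbelianGroup.Carrier V) : Set (c ⊔ ℓ ⊔ ℓ′) where
  private
    module A = AbelianGroup A
    module V = AbelianGroup V
  field
    additiveˡ   : ∀ y → IsAdditive A V (λ x → b x y)
    additiveʳ   : ∀ x → IsAdditive A V (b x)
    alternating : ∀ x → b x x V.≈ V.ε

  antisymmetric : ∀ x y → b x y V.≈ b y x V.⁻¹
  antisymmetric x y = AbelianGroupProperties.inverseˡ-unique V _ _ (begin
    b x y V.∙ b y x                      ≈⟨ V.∙-cong (V.identityˡ _) (V.identityʳ _) ⟨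
    (V.ε V.∙ b x y) V.∙ (b y x V.∙ V.ε)  ≈⟨ V.∙-cong (V.∙-congʳ (alternating x)) (V.∙-congˡ (alternating y)) ⟨
    (b x x V.∙ b x y) V.∙ (b y x V.∙ b y y)
      ≈⟨ V.∙-cong (IsAdditive.homo (additiveʳ x) x y) (IsAdditive.homo (additiveʳ y) x y) ⟨
    b x (x A.∙ y) V.∙ b y (x A.∙ y)      ≈⟨ IsAdditive.homo (additiveˡ (x A.∙ y)) x y ⟨
    b (x A.∙ y) (x A.∙ y)                ≈⟨ alternating (x A.∙ y) ⟩
    V.ε                                  ∎)
    where open SetoidReasoning V.setoid

Rad : (A : AbelianGroup c ℓ) (V : AbelianGroup c′ ℓ′) →
      (AbelianGroup.Carrier A → AbelianGroup.Carrier A → AbelianGroup.Carrier V) → Setoid (c ⊔ ℓ′) ℓ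
Rad A V b = SubSetoid (AbelianGroup.setoid A) (λ x → ∀ y → AbelianGroup._≈_ V (b x y) (AbelianGroup.ε V))

module _ (V : AbelianGroup 0ℓ 0ℓ) where
  private
    module V = AbelianGroup V
    module VP = AbelianGroupProperties V
    module V× = Mult V.commutativeMonoid
  open V× using () renaming (_×_ to _⋆_)

  module _ (_≟_ : ∀ u v → Dec (u V.≈ v)) (g : V.Carrier) (N : ℕ) (N>0 : 0 < N)
           (Ng≈ε : N ⋆ g V.≈ V.ε) (order : ∀ w → w ⋆ g V.≈ V.ε → N ∣ w) where

    -- Strong induction on the order. With n₁ = |x⊥| one has n = n₁ d, and the radical of x⊥ has
    -- order m d; the induction hypothesis n₁ = m d k² then gives n = m (k d)².
    size-radical : ∀ n → Acc _<_ n → (A : AbelianGroup c ℓ) → HasSize (AbelianGroup.setoid A) n →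
      ∀ {b} → IsAlternatingForm A V b → (∀ x y → ∃ λ w → b x y V.≈ w ⋆ g) →
      ∀ {m} → HasSize (Rad A V b) m → ∃ λ k → n ≡ m ℕ.* (k ℕ.* k)
    size-radical n (acc rec) A |A|≡n {b} form cyclic {m} |R|≡m = conclude d ≡.refl
      where
      module A = AbelianGroup A
      module A× = Mult A.commutativeMonoid
      open IsAlternatingForm form
      module bˡ y = IsAdditive (additiveˡ y)
      module bʳ x = IsAdditive (additiveʳ x)
      module E = Enumeration |A|≡n

      Value : ℕ → Set _
      Value i = 0 < i × ∃ λ x → ∃ λ y → b x y V.≈ i ⋆ g

      value? : ∀ i → Dec (Value i)
      value? i = 0 ℕ.<? i ×-dec
        E.any? (λ x≈x′ → λ { (y , eq) → y , V.trans (bˡ.cong y (A.sym x≈x′)) eq })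
          (λ x → E.any? (λ y≈y′ eq → V.trans (bʳ.cong x (A.sym y≈y′)) eq) (λ y → b x y ≟ (i ⋆ g)))

      -- `N` itself is a candidate, since b 0 0 = 0 = N g. So a minimum exists even when `b`
      -- vanishes, and then a = N.
      minimum : ∃ λ a → Value a × (∀ i → i < a → ¬ Value i)
      minimum = least value? N (N>0 , A.ε , A.ε , V.trans (bˡ.ε-homo A.ε) (V.sym Ng≈ε))

      a = proj₁ minimum
      x = proj₁ (proj₂ (proj₁ (proj₂ minimum)))
      y = proj₁ (proj₂ (proj₂ (proj₁ (proj₂ minimum))))
      bxy≈ag = proj₂ (proj₂ (proj₂ (proj₁ (proj₂ minimum))))
      a-minimal = proj₂ (proj₂ minimum)
      instance
        a≢0 : NonZero a
        a≢0 = ℕ.>-nonZero (proj₁ (proj₁ (proj₂ minimum)))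

      a∣bx : ∀ w z → b x z V.≈ w ⋆ g → a ∣ w
      a∣bx = least-multiple-divides A V (additiveʳ x) g y a bxy≈ag
        (λ i 0<i i<a z eq → a-minimal i i<a (0<i , x , z , eq))

      a∣by : ∀ w z → b z y V.≈ w ⋆ g → a ∣ w
      a∣by = least-multiple-divides A V (additiveˡ y) g x a bxy≈ag
        (λ i 0<i i<a z eq → a-minimal i i<a (0<i , z , y , eq))

      a∣N : a ∣ N
      -- The value b x 0 = 0 is written with coefficient `N` here, so that divisibility of
      -- coefficients speaks about `N`.
      a∣N = a∣bx N A.ε (V.trans (bʳ.ε-homo x) (V.sym Ng≈ε))

      d = _∣_.quotient a∣N
      N≡d*a : N ≡ d ℕ.* a
      N≡d*a = _∣_.equality a∣N

      instance
        d≢0 : NonZero d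
        d≢0 = ℕ.≢-nonZero λ d≡0 → ℕ.<⇒≢ N>0 (≡.sym (≡.trans N≡d*a (≡.cong (ℕ._* a) d≡0)))

      -- This element has order exactly `d`, and all values b x z and b z y are multiples of it.
      γ = a ⋆ g

      multiple-of-γ : ∀ {v} → (∃ λ w → v V.≈ w ⋆ g) → (∀ w → v V.≈ w ⋆ g → a ∣ w) → ∃ λ i → v V.≈ i ⋆ γ
      multiple-of-γ (w , v≈wg) a∣ with a∣ w v≈wg
      ... | divides i ≡.refl = i , V.trans v≈wg (V.sym (V×.×-assocˡ g i a))

      dγ≈ε : d ⋆ γ V.≈ V.ε
      dγ≈ε = V.trans (V×.×-assocˡ g d a) (V.trans (V×.×-congˡ (≡.sym N≡d*a)) Ng≈ε)

      γ-order : ∀ i → i ⋆ γ V.≈ V.ε → d ∣ i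
      γ-order i iγ≈ε = ℕ∣.*-cancelʳ-∣ a
        (≡.subst (_∣ i ℕ.* a) N≡d*a (order (i ℕ.* a) (V.trans (V.sym (V×.×-assocˡ g i a)) iγ≈ε)))

      bxz-multiple : ∀ z → ∃ λ i → b x z V.≈ i ⋆ γ
      bxz-multiple z = multiple-of-γ (cyclic x z) (λ w → a∣bx w z)

      x⊥ : IsSubgroup A (λ z → b x z V.≈ V.ε)
      x⊥ = ker-isSubgroup A V (additiveʳ x)

      A₁ : AbelianGroup _ _
      A₁ = subgroup A x⊥

      b₁ : AbelianGroup.Carrier A₁ → AbelianGroup.Carrier A₁ → V.Carrier
      b₁ z w = b (proj₁ z) (proj₁ w)

      form₁ : IsAlternatingForm A₁ V b₁
      form₁ = record
        { additiveˡ   = λ w → additive-∘ (additiveˡ (proj₁ w)) (additive-proj₁ x⊥)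
        ; additiveʳ   = λ z → additive-∘ (additiveʳ (proj₁ z)) (additive-proj₁ x⊥)
        ; alternating = λ z → alternating (proj₁ z)
        }

      R₁ : IsSubgroup A₁ (λ z → ∀ w → b₁ z w V.≈ V.ε)
      R₁ = record
        { ∙-closed  = λ {z} {w} z∈R w∈R t → IsSubgroup.∙-closed (K t) {z} {w} (z∈R t) (w∈R t)
        ; ε-closed  = λ t → IsSubgroup.ε-closed (K t)
        ; ⁻¹-closed = λ {z} z∈R t → IsSubgroup.⁻¹-closed (K t) {z} (z∈R t)
        }
        where
        K : ∀ t → IsSubgroup A₁ (λ z → b₁ z t V.≈ V.ε)
        K t = ker-isSubgroup A₁ V (IsAlternatingForm.additiveˡ form₁ t)

      |A₁| : ∃ (HasSize (AbelianGroup.setoid A₁))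
      |A₁| = subset-size |A|≡n (λ z≈z′ eq → V.trans (bʳ.cong x (A.sym z≈z′)) eq) (λ z → b x z ≟ V.ε)

      n₁ = proj₁ |A₁|

      n≡n₁*d : n ≡ n₁ ℕ.* d
      n≡n₁*d = size-unique |A|≡n (size-ker-im A V (additiveʳ x) (proj₂ |A₁|)
        (size-cyclic-image A V (additiveʳ x) γ y d bxy≈ag bxz-multiple dγ≈ε γ-order))

      b-y : AbelianGroup.Carrier (subgroup A₁ R₁) → V.Carrier
      b-y z = b (proj₁ (proj₁ z)) y

      b-y-additive : IsAdditive (subgroup A₁ R₁) V b-y
      b-y-additive = additive-∘ (additiveˡ y) (additive-∘ (additive-proj₁ x⊥) (additive-proj₁ R₁))

      -- On the radical of x⊥ the map `b-y` has kernel Rad b and image generated by `γ`. The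
      -- generator is attained at `x`, which lies in x⊥ because `b` is alternating, and in its
      -- radical because membership in x⊥ means pairing to 0 with `x`.
      |R₁| : HasSize (Rad A₁ V b₁) (m ℕ.* d)
      |R₁| = size-ker-im (subgroup A₁ R₁) V b-y-additive
        (size-transport
          (λ { (r , r∈R) → ((r , V.trans (antisymmetric x r) (V.trans (V.⁻¹-cong (r∈R x)) VP.ε⁻¹≈ε))
                           , (λ t → r∈R (proj₁ t))) , r∈R y })
          (λ eq → eq) (λ eq → eq)
          (λ { (((z , bxz≈ε) , z∈R₁) , bzy≈ε) → (z , radical z z∈R₁ bzy≈ε) , A.refl })
          |R|≡m)
        (size-cyclic-image (subgroup A₁ R₁) V b-y-additive γ ((x , alternating x) , proj₂) d bxy≈ag
          (λ z → multiple-of-γ (cyclic (proj₁ (proj₁ z)) y) (λ w → a∣by w _)) dγ≈ε γ-order)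
        where
        -- If b x t = i γ, then t - i y lies in x⊥ and pairs to 0 with `z`; so does i y, because b z
        -- y = 0.
        radical : ∀ z → (∀ t → b z (proj₁ {B = λ t → b x t V.≈ V.ε} t) V.≈ V.ε) →
                  b z y V.≈ V.ε → ∀ t → b z t V.≈ V.ε
        radical z z∈R₁ bzy≈ε t = let i , bxt≈iγ = bxz-multiple t in begin
          b z t                            ≈⟨ bʳ.cong z (AbelianGroupProperties.//-rightDividesˡ A (i A×.× y) t) ⟨
          b z (t A.∙ (i A×.× y) A.⁻¹ A.∙ (i A×.× y))
                                           ≈⟨ bʳ.homo z _ _ ⟩
          b z (t A.∙ (i A×.× y) A.⁻¹) V.∙ b z (i A×.× y)
            ≈⟨ V.∙-cong
                 (z∈R₁ (_ , ker-diff A V (additiveʳ x)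
                   (V.trans bxt≈iγ (V.sym (V.trans (bʳ.×-homo x i y) (V×.×-congʳ i bxy≈ag))))))
                 (IsAdditive.×-homo (additiveʳ z) i y) ⟩
          V.ε V.∙ i ⋆ b z y                ≈⟨ V.identityˡ _ ⟩
          i ⋆ b z y                        ≈⟨ ×-zeroʳ V i bzy≈ε ⟩
          V.ε                              ∎
          where open SetoidReasoning V.setoid

      -- If d = 1 then `N` is the least positive coefficient of any value. Division applied to b z
      -- with base point 0, whose value is N g, shows that `N` divides every coefficient, so every
      -- value vanishes.
      degenerate : d ≡ 1 → ∀ z t → b z t V.≈ V.ε
      degenerate d≡1 z t = let w , bzt≈wg = cyclic z t in
        V.trans bzt≈wg (N∣⇒≈ε (least-multiple-divides A V (additiveʳ z) g A.ε N (V.trans (bʳ.ε-homo z) (V.sym Ng≈ε))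
          (λ i 0<i i<N u eq → a-minimal i (≡.subst (i <_) N≡a i<N) (0<i , z , u , eq)) w t bzt≈wg))
        where
        instance
          N≢0 : NonZero N
          N≢0 = ℕ.>-nonZero N>0
        N≡a : N ≡ a
        N≡a = ≡.trans N≡d*a (≡.trans (≡.cong (ℕ._* a) d≡1) (ℕ.*-identityˡ a))
        N∣⇒≈ε : ∀ {w} → N ∣ w → w ⋆ g V.≈ V.ε
        N∣⇒≈ε (divides q ≡.refl) = V.trans (V.sym (V×.×-assocˡ g q N)) (×-zeroʳ V q Ng≈ε)

      n₁<n : 1 < d → n₁ < n
      n₁<n 1<d = ≡.subst (n₁ <_) (≡.sym n≡n₁*d) (ℕ.m<m*n n₁ d {{n₁≢0}} 1<d)
        where
        n₁≢0 : NonZero n₁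
        n₁≢0 = Fin.nonZeroIndex (Enumeration.index (proj₂ |A₁|) (AbelianGroup.ε A₁))

      conclude : ∀ d′ → d ≡ d′ → ∃ λ k → n ≡ m ℕ.* (k ℕ.* k)
      conclude zero          d≡0 = contradiction d≡0 (ℕ.≢-nonZero⁻¹ d)
      -- Here `b` is zero, so the radical is the whole group and k = 1.
      conclude (suc zero)    d≡1 = 1 , ≡.trans
        (size-unique |A|≡n (size-transport proj₁ (λ eq → eq) (λ eq → eq)
          (λ z → (z , degenerate d≡1 z) , A.refl) |R|≡m))
        (≡.sym (ℕ.*-identityʳ m))
      conclude (suc (suc _)) d≡2+ =
        let k , n₁≡ = size-radical n₁ (rec (n₁<n (≡.subst (1 <_) (≡.sym d≡2+) (ℕ.s<s ℕ.z<s)))) A₁ (proj₂ |A₁|) form₁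
                        (λ z w → cyclic (proj₁ z) (proj₁ w)) |R₁|
        in k ℕ.* d , ≡.trans n≡n₁*d (≡.trans (≡.cong (ℕ._* d) n₁≡) (rearrange m d k))
        where
        rearrange : ∀ m d k → m ℕ.* d ℕ.* (k ℕ.* k) ℕ.* d ≡ m ℕ.* (k ℕ.* d ℕ.* (k ℕ.* d))
        rearrange = solve-∀

-- ℚ/ℤ

-- `x ≈QZ y` unfolds to `Integral (x ℚ.- y)`. The laws of ℚ/ℤ thus reduce to ring identities in ℚ
-- and closure of the integers under sums and negatives.
Integral : ℚ → Set
Integral p = ℚ.denominator-1 p ≡ 0

-- Built directly in lowest terms, so that `denominator-1` is 0 by computation and integrality can
-- be matched with `refl`.
fromℤ : ℤ → ℚ
fromℤ k = mkℚ k 0 (Coprimality.sym (Coprimality.1-coprimeTo ℤ.∣ k ∣))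

integral⇒fromℤ : ∀ {p} → Integral p → ∃ λ k → p ≡ fromℤ k
integral⇒fromℤ {mkℚ k .0 _} ≡.refl = k , ≡.refl

fromℤ-homo-+ : ∀ j k → fromℤ j ℚ.+ fromℤ k ≡ fromℤ (j ℤ.+ k)
fromℤ-homo-+ j k = ≡.trans (ℚ./-cong (≡.cong₂ ℤ._+_ (ℤ.*-identityʳ j) (ℤ.*-identityʳ k)) ≡.refl)
                           (ℚ.↥p/↧p≡p (fromℤ (j ℤ.+ k)))

integral-+ : ∀ {p q} → Integral p → Integral q → Integral (p ℚ.+ q)
integral-+ {p} {q} ip iq with integral⇒fromℤ {p} ip | integral⇒fromℤ {q} iq
... | j , ≡.refl | k , ≡.refl = ≡.cong ℚ.denominator-1 (fromℤ-homo-+ j k)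

-- `ℚ.-_` computes only once the sign of the numerator is known, hence the three cases.
integral-neg : ∀ {p} → Integral p → Integral (ℚ.- p)
integral-neg {mkℚ -[1+ _ ]  _ _} ip = ip
integral-neg {mkℚ (+ zero)  _ _} ip = ip
integral-neg {mkℚ (+ suc _) _ _} ip = ip

private
  open +-*-Solver

  diff-swap : ∀ x y → ℚ.- (x ℚ.- y) ≡ y ℚ.- x
  diff-swap = solve 2 (λ x y → (:- (x :- y)) := (y :- x)) ≡.refl

  diff-trans : ∀ x y z → (x ℚ.- y) ℚ.+ (y ℚ.- z) ≡ x ℚ.- z
  diff-trans = solve 3 (λ x y z → ((x :- y) :+ (y :- z)) := (x :- z)) ≡.refl

  diff-+ : ∀ x y u v → (x ℚ.- y) ℚ.+ (u ℚ.- v) ≡ (x ℚ.+ u) ℚ.- (y ℚ.+ v)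
  diff-+ = solve 4 (λ x y u v → ((x :- y) :+ (u :- v)) := ((x :+ u) :- (y :+ v))) ≡.refl

  diff-neg : ∀ x y → ℚ.- (x ℚ.- y) ≡ (ℚ.- x) ℚ.- (ℚ.- y)
  diff-neg = solve 2 (λ x y → (:- (x :- y)) := ((:- x) :- (:- y))) ≡.refl

  halve : ∀ x → ½ ℚ.* (x ℚ.+ x) ≡ x
  halve = solve 1 (λ x → (con ½ :* (x :+ x)) := x) ≡.refl

  halve-odd : ∀ x → ½ ℚ.* (ℚ.1ℚ ℚ.+ (x ℚ.+ x)) ℚ.- ½ ≡ x
  halve-odd = solve 1 (λ x → ((con ½ :* (con ℚ.1ℚ :+ (x :+ x))) :- con ½) := x) ≡.refl

  diff-add : ∀ x y → (x ℚ.+ y) ℚ.- x ≡ y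
  diff-add = solve 2 (λ x y → ((x :+ y) :- x) := y) ≡.refl

≡⇒≈QZ : ∀ {x y} → x ≡ y → x ≈QZ y
≡⇒≈QZ {x} ≡.refl = ≡.cong ℚ.denominator-1 (ℚ.+-inverseʳ x)

QZ : AbelianGroup 0ℓ 0ℓ
QZ = record
  { Carrier = ℚ
  ; _≈_     = _≈QZ_
  ; _∙_     = ℚ._+_
  ; ε       = 0ℚ
  ; _⁻¹     = ℚ.-_
  ; isAbelianGroup = record
    { isGroup = record
      { isMonoid = record
        { isSemigroup = record
          { isMagma = record
            { isEquivalence = record
              { refl  = λ {x} → ≡⇒≈QZ {x} ≡.refl
              ; sym   = λ {x} {y} x≈y → ≡.subst Integral (diff-swap x y) (integral-neg {x ℚ.- y} x≈y)
              ; trans = λ {x} {y} {z} x≈y y≈z →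
                  ≡.subst Integral (diff-trans x y z) (integral-+ {x ℚ.- y} {y ℚ.- z} x≈y y≈z)
              }
            ; ∙-cong = λ {x} {y} {u} {v} x≈y u≈v →
                ≡.subst Integral (diff-+ x y u v) (integral-+ {x ℚ.- y} {u ℚ.- v} x≈y u≈v)
            }
          ; assoc = λ x y z → ≡⇒≈QZ (ℚ.+-assoc x y z)
          }
        ; identity = (λ x → ≡⇒≈QZ (ℚ.+-identityˡ x)) , (λ x → ≡⇒≈QZ (ℚ.+-identityʳ x))
        }
      ; inverse = (λ x → ≡⇒≈QZ (ℚ.+-inverseˡ x)) , (λ x → ≡⇒≈QZ (ℚ.+-inverseʳ x))
      ; ⁻¹-cong = λ {x} {y} x≈y → ≡.subst Integral (diff-neg x y) (integral-neg {x ℚ.- y} x≈y)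
      }
    ; comm = λ x y → ≡⇒≈QZ (ℚ.+-comm x y)
    }
  }

module QZ = AbelianGroup QZ

_≈QZ?_ : ∀ x y → Dec (x ≈QZ y)
x ≈QZ? y = ℚ.denominator-1 (x ℚ.- y) ℕ.≟ 0

+fromℤ≈ : ∀ x k → (x ℚ.+ fromℤ k) ≈QZ x
+fromℤ≈ x k = ≡.cong ℚ.denominator-1 (diff-add x (fromℤ k))

-- Write 2x as an integer `k`. Halving k = 2q gives x = q, and halving k = 2q + 1 gives x - ½ = q.
2-torsion : ∀ x → (x ℚ.+ x) ≈QZ 0ℚ → x ≈QZ 0ℚ ⊎ x ≈QZ ½
2-torsion x 2x≈0
  with integral⇒fromℤ {x ℚ.+ x} (≡.subst Integral (ℚ.+-identityʳ (x ℚ.+ x)) 2x≈0)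
... | k , 2x≡k = parity (k ℤ.%ℕ 2) (ℤ.n%ℕd<d k 2) (ℤ.a≡a%ℕn+[a/ℕn]*n k 2)
  where
  q = k ℤ./ℕ 2
  double : ∀ q → q ℤ.* + 2 ≡ q ℤ.+ q
  double = ℤSolver.solve-∀
  parity : ∀ r → r < 2 → k ≡ + r ℤ.+ q ℤ.* + 2 → x ≈QZ 0ℚ ⊎ x ≈QZ ½
  parity zero r<2 k≡ = inj₁ (≡.trans (≡.cong ℚ.denominator-1 (ℚ.+-identityʳ x)) (≡.cong ℚ.denominator-1 (begin
    x                            ≡⟨ halve x ⟨
    ½ ℚ.* (x ℚ.+ x)              ≡⟨ ≡.cong (½ ℚ.*_) 2x≡k ⟩
    ½ ℚ.* fromℤ k                ≡⟨ ≡.cong (λ k → ½ ℚ.* fromℤ k) (≡.trans k≡ (≡.trans (ℤ.+-identityˡ _) (double q))) ⟩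
    ½ ℚ.* fromℤ (q ℤ.+ q)        ≡⟨ ≡.cong (½ ℚ.*_) (fromℤ-homo-+ q q) ⟨
    ½ ℚ.* (fromℤ q ℚ.+ fromℤ q)  ≡⟨ halve (fromℤ q) ⟩
    fromℤ q                      ∎)))
    where open ≡.≡-Reasoning
  parity (suc zero) r<2 k≡ = inj₂ (≡.cong ℚ.denominator-1 (begin
    x ℚ.- ½                                    ≡⟨ ≡.cong (ℚ._- ½) (halve x) ⟨
    ½ ℚ.* (x ℚ.+ x) ℚ.- ½                      ≡⟨ ≡.cong (λ y → ½ ℚ.* y ℚ.- ½) 2x≡k ⟩
    ½ ℚ.* fromℤ k ℚ.- ½
      ≡⟨ ≡.cong (λ k → ½ ℚ.* fromℤ k ℚ.- ½) (≡.trans k≡ (≡.cong (λ i → + 1 ℤ.+ i) (double q))) ⟩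
    ½ ℚ.* fromℤ (+ 1 ℤ.+ (q ℤ.+ q)) ℚ.- ½      ≡⟨ ≡.cong (λ y → ½ ℚ.* y ℚ.- ½) (fromℤ-homo-+ (+ 1) (q ℤ.+ q)) ⟨
    ½ ℚ.* (ℚ.1ℚ ℚ.+ fromℤ (q ℤ.+ q)) ℚ.- ½     ≡⟨ ≡.cong (λ y → ½ ℚ.* (ℚ.1ℚ ℚ.+ y) ℚ.- ½) (fromℤ-homo-+ q q) ⟨
    ½ ℚ.* (ℚ.1ℚ ℚ.+ (fromℤ q ℚ.+ fromℤ q)) ℚ.- ½ ≡⟨ halve-odd (fromℤ q) ⟩
    fromℤ q                                    ∎))
    where open ≡.≡-Reasoning
  parity (suc (suc _)) (ℕ.s≤s (ℕ.s≤s ())) _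

-- Fractions and the cyclic subgroup generated by 1/n

open Mult QZ.commutativeMonoid using () renaming (_×_ to _⋆_)

-- In `ℚᵘ` fractions stay unreduced, so identities between fractions become integer identities by
-- cross-multiplication; this lemma carries them back to ℚ.
toℚᵘ-/ : ∀ i n .{{_ : NonZero n}} → ℚ.toℚᵘ (i ℚ./ n) ℚᵘ.≃ (i ℚᵘ./ n)
toℚᵘ-/ i (suc n) = ℚ.toℚᵘ-fromℚᵘ (ℚᵘ.mkℚᵘ i n)

/-homo-+ : ∀ i j n .{{_ : NonZero n}} → i ℚ./ n ℚ.+ j ℚ./ n ≡ (i ℤ.+ j) ℚ./ n
/-homo-+ i j n@(suc n-1) = ℚ.toℚᵘ-injective (begin
  ℚ.toℚᵘ (i ℚ./ n ℚ.+ j ℚ./ n)              ≈⟨ ℚ.toℚᵘ-homo-+ (i ℚ./ n) (j ℚ./ n) ⟩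
  ℚ.toℚᵘ (i ℚ./ n) ℚᵘ.+ ℚ.toℚᵘ (j ℚ./ n)    ≈⟨ ℚᵘ.+-cong (toℚᵘ-/ i n) (toℚᵘ-/ j n) ⟩
  (i ℚᵘ./ n) ℚᵘ.+ (j ℚᵘ./ n)                ≈⟨ ℚᵘ.*≡* (identity i j (+ n)) ⟩
  (i ℤ.+ j) ℚᵘ./ n                          ≈⟨ toℚᵘ-/ (i ℤ.+ j) n ⟨
  ℚ.toℚᵘ ((i ℤ.+ j) ℚ./ n)                  ∎)
  where
  open ℚᵘ.≃-Reasoning
  identity : ∀ i j n → (i ℤ.* n ℤ.+ j ℤ.* n) ℤ.* n ≡ (i ℤ.+ j) ℤ.* (n ℤ.* n)
  identity = ℤSolver.solve-∀

⋆-1/n : ∀ w n .{{_ : NonZero n}} → w ⋆ (+ 1 ℚ./ n) ≡ + w ℚ./ n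
⋆-1/n zero    n = ≡.sym (ℚ.0/n≡0 n)
⋆-1/n (suc w) n = ≡.trans (≡.cong (λ x → + 1 ℚ./ n ℚ.+ x) (⋆-1/n w n)) (/-homo-+ (+ 1) (+ w) n)

k*n/n≡k : ∀ k n .{{_ : NonZero n}} → (k ℤ.* + n) ℚ./ n ≡ fromℤ k
k*n/n≡k k n@(suc _) = ℚ.toℚᵘ-injective (ℚᵘ.≃-trans (toℚᵘ-/ (k ℤ.* + n) n) (ℚᵘ.*≡* (ℤ.*-identityʳ _)))

n⋆1/n≈0 : ∀ n .{{_ : NonZero n}} → (n ⋆ (+ 1 ℚ./ n)) ≈QZ 0ℚ
n⋆1/n≈0 n = QZ.trans {n ⋆ (+ 1 ℚ./ n)} {fromℤ (+ 1)} {0ℚ} (≡⇒≈QZ (≡.trans (⋆-1/n n n)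
  (≡.trans (ℚ./-cong (≡.sym (ℤ.*-identityˡ (+ n))) ≡.refl) (k*n/n≡k (+ 1) n)))) ≡.refl

-- If w/n is an integer `k`, cross-multiplication gives w = k n, and absolute values return to the
-- natural numbers.
order-1/n : ∀ n .{{_ : NonZero n}} w → (w ⋆ (+ 1 ℚ./ n)) ≈QZ 0ℚ → n ∣ w
order-1/n n@(suc _) w eq with integral⇒fromℤ {+ w ℚ./ n}
  (≡.subst Integral (≡.trans (ℚ.+-identityʳ _) (⋆-1/n w n)) eq)
... | k , w/n≡k with ℚᵘ.≃-trans (ℚᵘ.≃-sym (toℚᵘ-/ (+ w) n)) (ℚᵘ.≃-reflexive (≡.cong ℚ.toℚᵘ w/n≡k))
... | ℚᵘ.*≡* w*1≡k*n = divides ℤ.∣ k ∣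
  (≡.trans (≡.cong ℤ.∣_∣ (≡.trans (≡.sym (ℤ.*-identityʳ (+ w))) w*1≡k*n)) (ℤ.abs-* k (+ n)))

multiple-of-1/n : ∀ n .{{_ : NonZero n}} x → ℚ.↧ₙ x ∣ n → ∃ λ w → x ≈QZ (w ⋆ (+ 1 ℚ./ n))
multiple-of-1/n n@(suc _) x@record{} (divides t n≡t*d) = r , QZ.trans {x} {r/n ℚ.+ fromℤ q} {r ⋆ (+ 1 ℚ./ n)}
  (≡⇒≈QZ x≡r/n+q) (QZ.trans {r/n ℚ.+ fromℤ q} {r/n} {r ⋆ (+ 1 ℚ./ n)} (+fromℤ≈ r/n q) (≡⇒≈QZ (≡.sym (⋆-1/n r n))))
  where
  -- Scaling the numerator by `t` gives x = i/n. As `i` may be negative, its remainder `r` provides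
  -- the natural coefficient, and r/n differs from `x` by the integer `q`.
  i = ℚ.↥ x ℤ.* + t
  r = i ℤ.%ℕ n
  q = i ℤ./ℕ n
  r/n = + r ℚ./ n
  identity : ∀ a t d → a ℤ.* (t ℤ.* d) ≡ a ℤ.* t ℤ.* d
  identity = ℤSolver.solve-∀
  x≡i/n : x ≡ i ℚ./ n
  x≡i/n = ℚ.toℚᵘ-injective (ℚᵘ.≃-trans
    (ℚᵘ.*≡* (≡.trans (≡.cong (ℚ.↥ x ℤ.*_) (≡.trans (≡.cong +_ n≡t*d) (ℤ.pos-* t (ℚ.↧ₙ x))))
                     (identity (ℚ.↥ x) (+ t) (ℚ.↧ x))))
    (ℚᵘ.≃-sym (toℚᵘ-/ i n)))
  x≡r/n+q : x ≡ r/n ℚ.+ fromℤ q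
  x≡r/n+q = begin
    x                                    ≡⟨ x≡i/n ⟩
    i ℚ./ n                              ≡⟨ ℚ./-cong (ℤ.a≡a%ℕn+[a/ℕn]*n i n) ≡.refl ⟩
    (+ r ℤ.+ q ℤ.* + n) ℚ./ n            ≡⟨ /-homo-+ (+ r) (q ℤ.* + n) n ⟨
    r/n ℚ.+ (q ℤ.* + n) ℚ./ n            ≡⟨ ≡.cong (r/n ℚ.+_) (k*n/n≡k q n) ⟩
    r/n ℚ.+ fromℤ q                      ∎
    where open ≡.≡-Reasoning

-- Equality up to squares, and arithmetic of natural numbers

∼-intro : ∀ m n a b .{{_ : NonZero a}} .{{_ : NonZero b}} → m ℕ.* (a ℕ.* a) ≡ n ℕ.* (b ℕ.* b) → m ∼ n
-- The hypothesis says m = (b/a)² n, so b/a is the rational sought; it is nonzero because `b` is.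
∼-intro m n a@(suc a-1) b@(suc b-1) eq = + b ℚ./ a , b/a≢0 , ℚ.toℚᵘ-injective (begin
  ℚ.toℚᵘ (+ m ℚ./ 1)                                     ≈⟨ toℚᵘ-/ (+ m) 1 ⟩
  + m ℚᵘ./ 1                                              ≈⟨ ℚᵘ.*≡* cross ⟩
  (+ b ℚᵘ./ a) ℚᵘ.* (+ b ℚᵘ./ a) ℚᵘ.* (+ n ℚᵘ./ 1)
    ≈⟨ ℚᵘ.*-cong (ℚᵘ.*-cong (toℚᵘ-/ (+ b) a) (toℚᵘ-/ (+ b) a)) (toℚᵘ-/ (+ n) 1) ⟨
  ℚ.toℚᵘ (+ b ℚ./ a) ℚᵘ.* ℚ.toℚᵘ (+ b ℚ./ a) ℚᵘ.* ℚ.toℚᵘ (+ n ℚ./ 1)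
    ≈⟨ ℚᵘ.*-congʳ (ℚ.toℚᵘ-homo-* (+ b ℚ./ a) (+ b ℚ./ a)) ⟨
  ℚ.toℚᵘ (+ b ℚ./ a ℚ.* (+ b ℚ./ a)) ℚᵘ.* ℚ.toℚᵘ (+ n ℚ./ 1)
    ≈⟨ ℚ.toℚᵘ-homo-* (+ b ℚ./ a ℚ.* (+ b ℚ./ a)) (+ n ℚ./ 1) ⟨
  ℚ.toℚᵘ (+ b ℚ./ a ℚ.* (+ b ℚ./ a) ℚ.* (+ n ℚ./ 1))     ∎)
  where
  open ℚᵘ.≃-Reasoning
  b/a≢0 : + b ℚ./ a ≢ 0ℚ
  b/a≢0 b/a≡0 with ℚᵘ.≃-trans (ℚᵘ.≃-sym (toℚᵘ-/ (+ b) a)) (ℚᵘ.≃-reflexive (≡.cong ℚ.toℚᵘ b/a≡0))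
  ... | ℚᵘ.*≡* ()
  cross : + m ℤ.* + (a ℕ.* a ℕ.* 1) ≡ (+ b ℤ.* + b ℤ.* + n) ℤ.* + 1
  cross = ≡.trans (≡.sym (ℤ.pos-* m (a ℕ.* a ℕ.* 1))) (≡.trans (≡.cong +_
      (≡.trans (≡.cong (m ℕ.*_) (ℕ.*-identityʳ (a ℕ.* a))) (≡.trans eq (ℕ.*-comm n (b ℕ.* b)))))
    (≡.trans (ℤ.pos-* (b ℕ.* b) n) (≡.sym (ℤ.*-identityʳ _))))

-- The product of the entries serves. Applied first along rows and then to the results, it bounds
-- the denominators of a finite table of values.
common-multiple : ∀ n (f : Fin n → ℕ) → (∀ i → 0 < f i) → ∃ λ N → 0 < N × (∀ i → f i ∣ N)
common-multiple zero    f f>0 = 1 , ℕ.z<s , λ ()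
common-multiple (suc n) f f>0 with common-multiple n (λ i → f (suc i)) (λ i → f>0 (suc i))
... | N , N>0 , divs = f zero ℕ.* N , ℕ.*-mono-< (f>0 zero) N>0 ,
  λ { zero → ℕ∣.m∣m*n N ; (suc i) → ℕ∣.∣n⇒∣m*n (f zero) (divs i) }

-- Infinite descent: `l` is even, say l = 2j, so k² = 2j² with k < l. It keeps nonzero squares apart
-- from twice squares.
√2-irrational : ∀ {l} → Acc _<_ l → ∀ k → l ℕ.* l ≡ 2 ℕ.* (k ℕ.* k) → k ≡ 0
√2-irrational _ zero _ = ≡.refl
√2-irrational {l} (acc rec) k@(suc _) ll≡2kk
  with reduce (euclidsLemma l l prime[2] (divides (k ℕ.* k) (≡.trans ll≡2kk (ℕ.*-comm 2 (k ℕ.* k)))))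
... | divides j ≡.refl = k≡0
  where
  rearrange : ∀ j → j ℕ.* 2 ℕ.* (j ℕ.* 2) ≡ 2 ℕ.* (2 ℕ.* (j ℕ.* j))
  rearrange = solve-∀
  kk≡2jj : k ℕ.* k ≡ 2 ℕ.* (j ℕ.* j)
  kk≡2jj = ℕ.*-cancelˡ-≡ (k ℕ.* k) (2 ℕ.* (j ℕ.* j)) 2 (≡.trans (≡.sym ll≡2kk) (rearrange j))
  k<l : k < j ℕ.* 2
  k<l = ℕ.≰⇒> λ l≤k → ℕ.<⇒≱ (ℕ.m<m*n (k ℕ.* k) 2 (ℕ.s<s ℕ.z<s))
    (≡.subst (ℕ._≤ k ℕ.* k) (≡.trans ll≡2kk (ℕ.*-comm 2 (k ℕ.* k))) (ℕ.*-mono-≤ l≤k l≤k))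
  k≡0 : k ≡ 0
  k≡0 with √2-irrational (rec k<l) j kk≡2jj
  ... | ≡.refl = contradiction kk≡2jj (λ ())

nonZero-factors : ∀ n m k .{{_ : NonZero n}} → n ≡ m ℕ.* (k ℕ.* k) → NonZero m × NonZero k
nonZero-factors n m k n≡mkk = ℕ.≢-nonZero m≢0 , ℕ.≢-nonZero k≢0
  where
  m≢0 : m ≢ 0
  m≢0 ≡.refl = ℕ.≢-nonZero⁻¹ n n≡mkk
  k≢0 : k ≢ 0
  k≢0 ≡.refl = ℕ.≢-nonZero⁻¹ n (≡.trans n≡mkk (ℕ.*-zeroʳ m))

square-cofactor⇒∼ : ∀ n m k .{{_ : NonZero n}} → n ≡ m ℕ.* (k ℕ.* k) → m ∼ n
square-cofactor⇒∼ n m k n≡mkk = ∼-intro m n k 1 {{proj₂ (nonZero-factors n m k n≡mkk)}}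
  (≡.trans (≡.sym n≡mkk) (≡.sym (ℕ.*-identityʳ n)))

square-cofactors⇒∼ : ∀ n t d m k l .{{_ : NonZero n}} →
                     n ≡ t ℕ.* (k ℕ.* k) → n ≡ t ℕ.* d ℕ.* (l ℕ.* l) → (m ℕ.* d) ∼ m
square-cofactors⇒∼ n t d m k l n≡tkk n≡tdll =
  ∼-intro (m ℕ.* d) m l k {{proj₂ (nonZero-factors n (t ℕ.* d) l n≡tdll)}} {{proj₂ (nonZero-factors n t k n≡tkk)}}
    (≡.trans (ℕ.*-assoc m d (l ℕ.* l)) (≡.cong (m ℕ.*_) (ℕ.*-cancelˡ-≡ _ _ t {{proj₁ (nonZero-factors n t k n≡tkk)}}
      (≡.trans (≡.sym (ℕ.*-assoc t d (l ℕ.* l))) (≡.trans (≡.sym n≡tdll) n≡tkk)))))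

-- Counting kernels through alternating forms

-- The counting principle in the form that later modules take as a hypothesis: their forms have
-- values in an arbitrary group `V`, and `square-cofactors` provides it for perfect pairings into
-- ℚ/ℤ.
HasSquareCofactors : (A : AbelianGroup c ℓ) (V : AbelianGroup c′ ℓ′) → ℕ →
  (AbelianGroup.Carrier A → AbelianGroup.Carrier A → AbelianGroup.Carrier V) → Set (c ⊔ ℓ ⊔ ℓ′)
HasSquareCofactors A V n b = ∀ {g} → IsAdditive A A g →
  (∀ x → AbelianGroup._≈_ V (b (g x) x) (AbelianGroup.ε V)) →
  ∀ {m} → HasSize (Ker A A g) m → ∃ λ k → n ≡ m ℕ.* (k ℕ.* k)

module _ {A : AbelianGroup c ℓ} (P : Pairing A) where
  open AbelianGroup A
  open Pairing P renaming (cong to ⟨⟩-cong)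
  open SetoidReasoning QZ.setoid

  pairing-additiveˡ : ∀ y → IsAdditive A QZ (λ x → ⟨ x , y ⟩)
  pairing-additiveˡ y = record { cong = λ eq → ⟨⟩-cong eq refl ; homo = λ x x′ → linˡ x x′ y }

  pairing-additiveʳ : ∀ x → IsAdditive A QZ ⟨ x ,_⟩
  pairing-additiveʳ x = record { cong = λ eq → ⟨⟩-cong refl eq ; homo = λ y y′ → linʳ x y y′ }

  -- Modulo ℤ only the values on pairs of representatives occur. A common multiple `N` of their
  -- denominators puts all values into the cyclic subgroup generated by 1/N.
  bounded-denominators : ∀ {n} → HasSize setoid n →
    ∃ λ N → Σ (NonZero N) λ N≢0 → ∀ x y → ∃ λ w →
      ⟨ x , y ⟩ ≈QZ (w ⋆ ℚ._/_ (+ 1) N {{N≢0}})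
  bounded-denominators {n} I =
    let N , N>0 , divs = common-multiple n (λ i → proj₁ (row i)) (λ i → proj₁ (proj₂ (row i)))
        instance N≢0 = ℕ.>-nonZero N>0
    in N , N≢0 , λ x y →
      let i = index x ; j = index y
          w , eq = multiple-of-1/n N ⟨ element i , element j ⟩ (ℕ∣.∣-trans (proj₂ (proj₂ (row i)) j) (divs i))
      in w , (begin
        ⟨ x , y ⟩                    ≈⟨ ⟨⟩-cong (element-index x) (element-index y) ⟨
        ⟨ element i , element j ⟩    ≈⟨ eq ⟩
        w ⋆ (+ 1 ℚ./ N)              ∎)
    where
    open Enumeration I
    row : ∀ i → ∃ λ N → 0 < N × (∀ j → ℚ.↧ₙ ⟨ element i , element j ⟩ ∣ N)
    row i = common-multiple n (λ j → ℚ.↧ₙ ⟨ element i , element j ⟩) (λ j → ℕ.z<s)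

  -- `size-radical` is applied to the alternating form (x, y) ↦ ⟨g x , y⟩, whose radical is Ker g
  -- because the pairing is non-degenerate on the left.
  square-cofactors : ∀ {n} → HasSize setoid n → Perfect A P → HasSquareCofactors A QZ n ⟨_,_⟩
  square-cofactors {n} I perfect {g} g+ alternating J = let N , N≢0 , cyclic = bounded-denominators I in
    size-radical QZ _≈QZ?_ (ℚ._/_ (+ 1) N {{N≢0}}) N (ℕ.>-nonZero⁻¹ N {{N≢0}})
      (n⋆1/n≈0 N {{N≢0}}) (order-1/n N {{N≢0}}) n (<-wellFounded n) A I
      record { additiveˡ   = λ y → additive-∘ (pairing-additiveˡ y) g+
             ; additiveʳ   = λ x → pairing-additiveʳ (g x)
             ; alternating = alternating }
      (λ x y → cyclic (g x) y)
      (size-⇔ {P = λ x → g x ≈ ε} {Q = λ x → ∀ y → ⟨ g x , y ⟩ ≈QZ 0ℚ}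
        (λ x gx≈ε y → begin
          ⟨ g x , y ⟩  ≈⟨ ⟨⟩-cong gx≈ε refl ⟩
          ⟨ ε , y ⟩    ≈⟨ IsAdditive.ε-homo (pairing-additiveˡ y) ⟩
          0ℚ           ∎)
        (λ x gx∈Rad → Perfect.injˡ perfect (g x) ε (λ y → begin
          ⟨ g x , y ⟩  ≈⟨ gx∈Rad y ⟩
          0ℚ           ≈⟨ IsAdditive.ε-homo (pairing-additiveˡ y) ⟨
          ⟨ ε , y ⟩    ∎)) J)

-- Antisymmetric pairings

module _ {A : AbelianGroup c ℓ} where
  private
    module A = AbelianGroup A
    module A× = Mult A.commutativeMonoid

  ·≡× : ∀ n x → _·_ A n x ≡ n A×.× x
  ·≡× zero    x = ≡.refl
  ·≡× (suc n) x = ≡.cong (x A.∙_) (·≡× n x)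

  ×-additive : ∀ e → IsAdditive A A (e A×.×_)
  ×-additive e = record { cong = A×.×-congʳ e ; homo = λ x y → A×.×-distrib-+ x y e }

  Torsion⇒Ker : ∀ e {m} → HasSize (Torsion A e) m → HasSize (Ker A A (e A×.×_)) m
  Torsion⇒Ker e = size-⇔ (λ x → A.trans (A.reflexive (≡.sym (·≡× e x)))) (λ x → A.trans (A.reflexive (·≡× e x)))

module AntisymmetricForm (A : AbelianGroup c ℓ) (V : AbelianGroup c′ ℓ′) where
  open AbelianGroup A
  private
    module V = AbelianGroup V
    module AP = AbelianGroupProperties A
    module VP = AbelianGroupProperties V
    module A× = Mult commutativeMonoid
    module V× = Mult V.commutativeMonoid

  module Finite {n : ℕ} (|A| : HasSize setoid n) {b : Carrier → Carrier → V.Carrier}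
    (additiveˡ : ∀ y → IsAdditive A V (λ x → b x y)) (additiveʳ : ∀ x → IsAdditive A V (b x))
    (antisym : ∀ x y → b x y V.≈ b y x V.⁻¹) (squares : HasSquareCofactors A V n b) where
    private
      module E = Enumeration |A|

      instance
        n≢0 : NonZero n
        n≢0 = Fin.nonZeroIndex (E.index ε)

    q : Carrier → V.Carrier
    q x = b x x

    2q≈ε : ∀ x → q x V.∙ q x V.≈ V.ε
    2q≈ε x = V.trans (V.∙-congˡ (antisym x x)) (V.inverseʳ (q x))

    -- Antisymmetry cancels the cross terms b x y and b y x.
    q-additive : IsAdditive A V q
    q-additive = record
      { cong = λ {x} {y} x≈y → V.trans (IsAdditive.cong (additiveˡ x) x≈y) (IsAdditive.cong (additiveʳ y) x≈y)
      ; homo = λ x y → begin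
          b (x ∙ y) (x ∙ y)                          ≈⟨ IsAdditive.homo (additiveˡ (x ∙ y)) x y ⟩
          b x (x ∙ y) V.∙ b y (x ∙ y)
            ≈⟨ V.∙-cong (IsAdditive.homo (additiveʳ x) x y) (IsAdditive.homo (additiveʳ y) x y) ⟩
          (q x V.∙ b x y) V.∙ (b y x V.∙ q y)        ≈⟨ V.∙-congˡ (V.∙-congʳ (antisym y x)) ⟩
          (q x V.∙ b x y) V.∙ (b x y V.⁻¹ V.∙ q y)   ≈⟨ V.assoc (q x) _ _ ⟩
          q x V.∙ (b x y V.∙ (b x y V.⁻¹ V.∙ q y))   ≈⟨ V.∙-congˡ (VP.\\-leftDividesˡ (b x y) (q y)) ⟩
          q x V.∙ q y                                ∎
      }
      where open SetoidReasoning V.setoid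
    private module q = IsAdditive q-additive

    -- Multiplication by 2j is admissible as `g`, since b (2j x) x = j (2 q x) = 0.
    even-torsion : ∀ j {m} → HasSize (Ker A A ((j ℕ.* 2) A×.×_)) m → ∃ λ k → n ≡ m ℕ.* (k ℕ.* k)
    even-torsion j = squares (×-additive {A = A} (j ℕ.* 2)) λ x → begin
      b ((j ℕ.* 2) A×.× x) x      ≈⟨ IsAdditive.×-homo (additiveˡ x) (j ℕ.* 2) x ⟩
      (j ℕ.* 2) V×.× q x          ≈⟨ V×.×-assocˡ (q x) j 2 ⟨
      j V×.× (2 V×.× q x)         ≈⟨ ×-zeroʳ V j (V.trans (V.∙-congˡ (V.identityʳ _)) (2q≈ε x)) ⟩
      V.ε                         ∎
      where open SetoidReasoning V.setoid

    even-torsion∼ : ∀ j {m} → HasSize (Ker A A ((j ℕ.* 2) A×.×_)) m → m ∼ n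
    even-torsion∼ j {m} I = let k , n≡ = even-torsion j I in square-cofactor⇒∼ n m k n≡

    -- Doubling maps A[2e] onto A[e] with kernel A[2], so |A[2e]| = |A[2]| m. Both |A[2e]| and
    -- |A[2]| have square cofactors in `n`, hence `m` is a square up to rational squares.
    odd-torsion∼1 : ∀ j {m} → HasSize (Ker A A (suc (j ℕ.* 2) A×.×_)) m → m ∼ 1
    odd-torsion∼1 j {m} |A[e]| =
      let e = suc (j ℕ.* 2)
          t , |A[2]| = subset-size |A| (λ eq → trans (A×.×-congʳ 2 (sym eq))) (λ x → 2 A×.× x E.≈? ε)
          open SetoidReasoning setoid
          2e = e ℕ.* 2
          A[2e] = ker-isSubgroup A A (×-additive {A = A} 2e)
          |A[2e]| : HasSize (Ker A A (2e A×.×_)) (t ℕ.* m)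
          |A[2e]| = size-ker-im (subgroup A A[2e]) A (additive-∘ (×-additive {A = A} 2) (additive-proj₁ A[2e]))
            (size-transport
              (λ { (x , 2x≈ε) → (x , trans (sym (A×.×-assocˡ x e 2)) (×-zeroʳ A e 2x≈ε)) , 2x≈ε })
              (λ eq → eq) (λ eq → eq) (λ { ((x , _) , 2x≈ε) → (x , 2x≈ε) , refl }) |A[2]|)
            (size-⇔ {S = setoid}
              (λ u eu≈ε →
                -- Since 2 (j + 1) = e + 1 and e u = 0, this `v` is a half of `u`.
                let v = suc j A×.× u
                    2v≈u = begin
                      2 A×.× v                    ≈⟨ A×.×-assocˡ u 2 (suc j) ⟩
                      (2 ℕ.* suc j) A×.× u        ≈⟨ A×.×-congˡ (ℕ.*-comm 2 (suc j)) ⟩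
                      u ∙ (e A×.× u)              ≈⟨ ∙-congˡ eu≈ε ⟩
                      u ∙ ε                       ≈⟨ identityʳ u ⟩
                      u                           ∎
                in (v , (begin
                      2e A×.× v            ≈⟨ A×.×-assocˡ v e 2 ⟨
                      e A×.× (2 A×.× v)    ≈⟨ A×.×-congʳ e 2v≈u ⟩
                      e A×.× u             ≈⟨ eu≈ε ⟩
                      ε                    ∎)) , 2v≈u)
              (λ { u ((v , 2ev≈ε) , 2v≈u) → begin
                e A×.× u                 ≈⟨ A×.×-congʳ e 2v≈u ⟨
                e A×.× (2 A×.× v)        ≈⟨ A×.×-assocˡ v e 2 ⟩
                2e A×.× v                ≈⟨ 2ev≈ε ⟩
                ε                        ∎ })
              |A[e]|)
          k , n≡tkk = even-torsion 1 |A[2]|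
          l , n≡tmll = even-torsion e |A[2e]|
      in ≡.subst (_∼ 1) (ℕ.*-identityˡ m) (square-cofactors⇒∼ n t m 1 k l n≡tkk n≡tmll)

    -- Twisting by the diagonal character `q`

    module Twist (_≟_ : ∀ u v → Dec (u V.≈ v)) (half : V.Carrier) (2half≈ε : half V.∙ half V.≈ V.ε)
      (2-torsion : ∀ v → v V.∙ v V.≈ V.ε → v V.≈ V.ε ⊎ v V.≈ half)
      (injective : ∀ x y → (∀ z → b x z V.≈ b y z) → x ≈ y)
      (c : Carrier) (c-represents : ∀ x → b c x V.≈ q x)
      where

      2c≈ε : c ∙ c ≈ ε
      2c≈ε = injective (c ∙ c) ε λ z → begin
        b (c ∙ c) z          ≈⟨ IsAdditive.homo (additiveˡ z) c c ⟩
        b c z V.∙ b c z      ≈⟨ V.∙-cong (c-represents z) (c-represents z) ⟩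
        q z V.∙ q z          ≈⟨ 2q≈ε z ⟩
        V.ε                  ≈⟨ IsAdditive.ε-homo (additiveˡ z) ⟨
        b ε z                ∎
        where open SetoidReasoning V.setoid

      -- By `2-torsion`, `half` is the only candidate for a nonzero value of `q`, so two nonzero
      -- values agree and cancel. This is the case of additivity of `shift` where `c` occurs twice.
      q+q≈ε : ∀ {x y} → ¬ (q x V.≈ V.ε) → ¬ (q y V.≈ V.ε) → q x V.∙ q y V.≈ V.ε
      q+q≈ε {x} {y} qx≉ε qy≉ε with 2-torsion (q x) (2q≈ε x) | 2-torsion (q y) (2q≈ε y)
      ... | inj₁ qx≈ε | _         = contradiction qx≈ε qx≉ε
      ... | inj₂ _    | inj₁ qy≈ε = contradiction qy≈ε qy≉ε
      ... | inj₂ qx≈h | inj₂ qy≈h = V.trans (V.∙-cong qx≈h qy≈h) 2half≈ε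

      -- With `q` read as a character into ℤ/2, this is x ↦ q(x) c.
      shift : Carrier → Carrier
      shift x with q x ≟ V.ε
      ... | yes _ = ε
      ... | no  _ = c

      shift-≈ε : ∀ {x} → q x V.≈ V.ε → shift x ≈ ε
      shift-≈ε {x} qx≈ε with q x ≟ V.ε
      ... | yes _    = refl
      ... | no  qx≉ε = contradiction qx≈ε qx≉ε

      shift-≉ε : ∀ {x} → ¬ (q x V.≈ V.ε) → shift x ≈ c
      shift-≉ε {x} qx≉ε with q x ≟ V.ε
      ... | yes qx≈ε = contradiction qx≈ε qx≉ε
      ... | no  _    = refl

      shift-additive : IsAdditive A A shift
      shift-additive = record { cong = shift-cong ; homo = shift-homo }
        where
        open SetoidReasoning setoid
        shift-cong : ∀ {x y} → x ≈ y → shift x ≈ shift y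
        shift-cong {x} {y} x≈y = helper (q x ≟ V.ε)
          where
          helper : Dec (q x V.≈ V.ε) → shift x ≈ shift y
          helper (yes qx≈ε) = trans (shift-≈ε qx≈ε) (sym (shift-≈ε (V.trans (q.cong (sym x≈y)) qx≈ε)))
          helper (no  qx≉ε) = trans (shift-≉ε qx≉ε) (sym (shift-≉ε (λ qy≈ε → qx≉ε (V.trans (q.cong x≈y) qy≈ε))))
        shift-homo : ∀ x y → shift (x ∙ y) ≈ shift x ∙ shift y
        shift-homo x y = helper (q x ≟ V.ε) (q y ≟ V.ε)
          where
          helper : Dec (q x V.≈ V.ε) → Dec (q y V.≈ V.ε) → shift (x ∙ y) ≈ shift x ∙ shift y
          helper (yes qx≈ε) (yes qy≈ε) = begin
            shift (x ∙ y)      ≈⟨ shift-≈ε (V.trans (q.homo x y) (V.trans (V.∙-cong qx≈ε qy≈ε) (V.identityˡ _))) ⟩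
            ε                  ≈⟨ identityˡ ε ⟨
            ε ∙ ε              ≈⟨ ∙-cong (shift-≈ε qx≈ε) (shift-≈ε qy≈ε) ⟨
            shift x ∙ shift y  ∎
          helper (yes qx≈ε) (no qy≉ε) = begin
            shift (x ∙ y)      ≈⟨ shift-≉ε (λ eq → qy≉ε (V.trans (V.sym (V.trans (V.∙-congʳ qx≈ε) (V.identityˡ _)))
                                  (V.trans (V.sym (q.homo x y)) eq))) ⟩
            c                  ≈⟨ identityˡ c ⟨
            ε ∙ c              ≈⟨ ∙-cong (shift-≈ε qx≈ε) (shift-≉ε qy≉ε) ⟨
            shift x ∙ shift y  ∎
          helper (no qx≉ε) (yes qy≈ε) = begin
            shift (x ∙ y)      ≈⟨ shift-≉ε (λ eq → qx≉ε (V.trans (V.sym (V.trans (V.∙-congˡ qy≈ε) (V.identityʳ _)))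
                                  (V.trans (V.sym (q.homo x y)) eq))) ⟩
            c                  ≈⟨ identityʳ c ⟨
            c ∙ ε              ≈⟨ ∙-cong (shift-≉ε qx≉ε) (shift-≈ε qy≈ε) ⟨
            shift x ∙ shift y  ∎
          helper (no qx≉ε) (no qy≉ε) = begin
            shift (x ∙ y)      ≈⟨ shift-≈ε (V.trans (q.homo x y) (q+q≈ε qx≉ε qy≉ε)) ⟩
            ε                  ≈⟨ 2c≈ε ⟨
            c ∙ c              ≈⟨ ∙-cong (shift-≉ε qx≉ε) (shift-≉ε qy≉ε) ⟨
            shift x ∙ shift y  ∎

      twist : Carrier → Carrier
      twist x = x ∙ shift x

      twist-additive : IsAdditive A A twist
      twist-additive = additive-∙ additive-id shift-additive

      -- When q x ≠ 0, the added `c` contributes b c x = q x, and 2 q x = 0.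
      twist-alternating : ∀ x → b (twist x) x V.≈ V.ε
      twist-alternating x = V.trans (IsAdditive.homo (additiveˡ x) x (shift x)) (helper (q x ≟ V.ε))
        where
        open SetoidReasoning V.setoid
        helper : Dec (q x V.≈ V.ε) → q x V.∙ b (shift x) x V.≈ V.ε
        helper (yes qx≈ε) = begin
          q x V.∙ b (shift x) x  ≈⟨ V.∙-cong qx≈ε (IsAdditive.cong (additiveˡ x) (shift-≈ε qx≈ε)) ⟩
          V.ε V.∙ b ε x          ≈⟨ V.identityˡ _ ⟩
          b ε x                  ≈⟨ IsAdditive.ε-homo (additiveˡ x) ⟩
          V.ε                    ∎
        helper (no qx≉ε) = begin
          q x V.∙ b (shift x) x  ≈⟨ V.∙-congˡ (IsAdditive.cong (additiveˡ x) (shift-≉ε qx≉ε)) ⟩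
          q x V.∙ b c x          ≈⟨ V.∙-congˡ (c-represents x) ⟩
          q x V.∙ q x            ≈⟨ 2q≈ε x ⟩
          V.ε                    ∎

      -- Let s be `shift`. Its values are 0 or `c`, so 2s = 0, and q c = 0 gives s² = 0. Hence (1 +
      -- s)² = 1 + 2s + s² = 1.
      twist-involutive : q c V.≈ V.ε → ∀ x → twist (twist x) ≈ x
      twist-involutive qc≈ε x = begin
        (x ∙ shift x) ∙ shift (x ∙ shift x)          ≈⟨ ∙-congˡ (IsAdditive.homo shift-additive x (shift x)) ⟩
        (x ∙ shift x) ∙ (shift x ∙ shift (shift x))  ≈⟨ ∙-congˡ (trans (∙-congˡ (shift-≈ε qs≈ε)) (identityʳ _)) ⟩
        (x ∙ shift x) ∙ shift x                      ≈⟨ assoc x (shift x) (shift x) ⟩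
        x ∙ (shift x ∙ shift x)                      ≈⟨ ∙-congˡ (proj₂ (s (q x ≟ V.ε))) ⟩
        x ∙ ε                                        ≈⟨ identityʳ x ⟩
        x                                            ∎
        where
        open SetoidReasoning setoid
        s : Dec (q x V.≈ V.ε) → q (shift x) V.≈ V.ε × shift x ∙ shift x ≈ ε
        s (yes qx≈ε) = V.trans (q.cong (shift-≈ε qx≈ε)) q.ε-homo ,
                       trans (∙-cong (shift-≈ε qx≈ε) (shift-≈ε qx≈ε)) (identityˡ ε)
        s (no  qx≉ε) = V.trans (q.cong (shift-≉ε qx≉ε)) qc≈ε ,
                       trans (∙-cong (shift-≉ε qx≉ε) (shift-≉ε qx≉ε)) 2c≈ε
        qs≈ε : q (shift x) V.≈ V.ε
        qs≈ε = proj₁ (s (q x ≟ V.ε))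

      square : q c V.≈ V.ε → ∃ λ k → n ≡ 1 ℕ.* (k ℕ.* k)
      square qc≈ε = squares twist-additive twist-alternating {1}
        (size-bijection {m = 1} (λ _ → ε , IsAdditive.ε-homo twist-additive)
          (λ { {zero} {zero} _ → ≡.refl })
          (λ { (x , tx≈ε) → zero , (begin
            ε                ≈⟨ IsAdditive.ε-homo twist-additive ⟨
            twist ε          ≈⟨ IsAdditive.cong twist-additive tx≈ε ⟨
            twist (twist x)  ≈⟨ twist-involutive qc≈ε x ⟩
            x                ∎) }))
        where open SetoidReasoning setoid

      twice-square : ¬ (q c V.≈ V.ε) → ∃ λ k → n ≡ 2 ℕ.* (k ℕ.* k)
      twice-square qc≉ε = squares twist-additive twist-alternating {2}
        (size-bijection f (λ {i} {j} → f-injective i j) (λ { (x , tx≈ε) → f-surjective x tx≈ε (q x ≟ V.ε) }))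
        where
        f : Fin 2 → Setoid.Carrier (Ker A A twist)
        f zero    = ε , IsAdditive.ε-homo twist-additive
        f (suc _) = c , trans (∙-congˡ (shift-≉ε qc≉ε)) 2c≈ε
        c≉ε : ¬ (c ≈ ε)
        c≉ε c≈ε = qc≉ε (V.trans (q.cong c≈ε) q.ε-homo)
        f-injective : ∀ i j → proj₁ (f i) ≈ proj₁ (f j) → i ≡ j
        f-injective zero       zero       _  = ≡.refl
        f-injective zero       (suc zero) eq = contradiction (sym eq) c≉ε
        f-injective (suc zero) zero       eq = contradiction eq c≉ε
        f-injective (suc zero) (suc zero) _  = ≡.refl
        f-surjective : ∀ x → twist x ≈ ε → Dec (q x V.≈ V.ε) → ∃ λ i → proj₁ (f i) ≈ x
        f-surjective x tx≈ε (yes qx≈ε) = zero , sym (trans (sym (trans (∙-congˡ (shift-≈ε qx≈ε)) (identityʳ x))) tx≈ε)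
        -- Here the twist adds `c`, so x + c = 0 = c + c, and `c` cancels.
        f-surjective x tx≈ε (no  qx≉ε) = suc zero ,
          AP.∙-cancelʳ c c x (trans 2c≈ε (sym (trans (∙-congˡ (sym (shift-≉ε qx≉ε))) tx≈ε)))

-- Isometries

module AutomorphismPowers {A : AbelianGroup c ℓ} (φ : Automorphism A) where
  open AbelianGroup A
  open Automorphism φ
  private module AP = AbelianGroupProperties A

  infixr 8 F^_ F⁻^_
  F^_ F⁻^_ : ℕ → Carrier → Carrier
  F^_  = iter A F
  F⁻^_ = iter A F⁻¹

  F-additive : IsAdditive A A F
  F-additive = record { cong = F-cong ; homo = F-hom }

  F⁻¹-additive : IsAdditive A A F⁻¹
  F⁻¹-additive = record
    { cong = F⁻¹-cong
    ; homo = λ x y → begin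
        F⁻¹ (x ∙ y)                      ≈⟨ F⁻¹-cong (∙-cong (F∘F⁻¹ x) (F∘F⁻¹ y)) ⟨
        F⁻¹ (F (F⁻¹ x) ∙ F (F⁻¹ y))      ≈⟨ F⁻¹-cong (F-hom (F⁻¹ x) (F⁻¹ y)) ⟨
        F⁻¹ (F (F⁻¹ x ∙ F⁻¹ y))          ≈⟨ F⁻¹∘F _ ⟩
        F⁻¹ x ∙ F⁻¹ y                    ∎
    }
    where open SetoidReasoning setoid

  iter-additive : ∀ {h} → IsAdditive A A h → ∀ k → IsAdditive A A (iter A h k)
  iter-additive h+ zero    = additive-id
  iter-additive h+ (suc k) = additive-∘ h+ (iter-additive h+ k)

  iter-comm : ∀ (h : Carrier → Carrier) k x → iter A h k (h x) ≡ h (iter A h k x)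
  iter-comm h zero    x = ≡.refl
  iter-comm h (suc k) x = ≡.cong h (iter-comm h k x)

  iter-+ : ∀ (h : Carrier → Carrier) j k x → iter A h (j ℕ.+ k) x ≡ iter A h j (iter A h k x)
  iter-+ h zero    k x = ≡.refl
  iter-+ h (suc j) k x = ≡.cong h (iter-+ h j k x)

  iter-cancel : ∀ {h h′} → IsAdditive A A h → (∀ x → h (h′ x) ≈ x) → ∀ k x → iter A h k (iter A h′ k x) ≈ x
  iter-cancel h+ hh′ zero    x = refl
  iter-cancel {h} {h′} h+ hh′ (suc k) x = begin
    h (iter A h k (h′ (iter A h′ k x)))  ≡⟨ iter-comm h k _ ⟨
    iter A h k (h (h′ (iter A h′ k x)))  ≈⟨ IsAdditive.cong (iter-additive h+ k) (hh′ _) ⟩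
    iter A h k (iter A h′ k x)           ≈⟨ iter-cancel h+ hh′ k x ⟩
    x                                    ∎
    where open SetoidReasoning setoid

  F^-additive : ∀ k → IsAdditive A A (F^ k)
  F^-additive = iter-additive F-additive

  F⁻^-additive : ∀ k → IsAdditive A A (F⁻^ k)
  F⁻^-additive = iter-additive F⁻¹-additive

  F^-F⁻^ : ∀ k x → (F^ k) ((F⁻^ k) x) ≈ x
  F^-F⁻^ = iter-cancel F-additive F∘F⁻¹

  F⁻^-F^ : ∀ k x → (F⁻^ k) ((F^ k) x) ≈ x
  F⁻^-F^ = iter-cancel F⁻¹-additive F⁻¹∘F

  F^-double : ∀ k x → (F^ (k ℕ.* 2)) x ≡ (F^ k) ((F^ k) x)
  F^-double k x = ≡.trans (≡.cong (λ j → (F^ j) x) (≡.trans (ℕ.*-comm k 2) (≡.cong (k ℕ.+_) (ℕ.+-identityʳ k))))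
                          (iter-+ F k k x)

  F^-fixed : ∀ k {x} → F x ≈ x → (F^ k) x ≈ x
  F^-fixed zero    Fx≈x = refl
  F^-fixed (suc k) Fx≈x = trans (F-cong (F^-fixed k Fx≈x)) Fx≈x

  -- The endomorphism F^k - 1; its kernel is the subgroup fixed by F^k.
  δ : ℕ → Carrier → Carrier
  δ k x = (F^ k) x ∙ x ⁻¹

  δ-additive : ∀ k → IsAdditive A A (δ k)
  δ-additive k = additive-∙ (F^-additive k) (additive-⁻¹ additive-id)

  δ-F : ∀ k x → δ k (F x) ≈ F (δ k x)
  δ-F k x = begin
    (F^ k) (F x) ∙ F x ⁻¹   ≡⟨ ≡.cong (_∙ F x ⁻¹) (iter-comm F k x) ⟩
    F ((F^ k) x) ∙ F x ⁻¹   ≈⟨ IsAdditive.-‿homo F-additive ((F^ k) x) x ⟨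
    F (δ k x)               ∎
    where open SetoidReasoning setoid

  Fixed⇒Ker-δ : ∀ k {m} → HasSize (Fixed A φ (+ k)) m → HasSize (Ker A A (δ k)) m
  Fixed⇒Ker-δ k = size-⇔ (λ x → AP.x≈y⇒x∙y⁻¹≈ε) (λ x → AP.x∙y⁻¹≈ε⇒x≈y _ _)

  -- Applying F^k to F^(-k) x = x, or F^(-k) to F^k x = x, shows that an exponent and its negative
  -- have the same fixed points.
  Fixed-abs : ∀ f {m} → HasSize (Fixed A φ f) m → HasSize (Fixed A φ (+ ℤ.∣ f ∣)) m
  Fixed-abs (+ k)    I = I
  Fixed-abs -[1+ k ] I = size-⇔
    (λ x F⁻x≈x → trans (IsAdditive.cong (F^-additive (suc k)) (sym F⁻x≈x)) (F^-F⁻^ (suc k) x))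
    (λ x Fx≈x → trans (IsAdditive.cong (F⁻^-additive (suc k)) (sym Fx≈x)) (F⁻^-F^ (suc k) x)) I

  telescope : ∀ x y z → (x ∙ y ⁻¹) ∙ (y ∙ z ⁻¹) ≈ x ∙ z ⁻¹
  telescope x y z = begin
    (x ∙ y ⁻¹) ∙ (y ∙ z ⁻¹)  ≈⟨ assoc x (y ⁻¹) _ ⟩
    x ∙ (y ⁻¹ ∙ (y ∙ z ⁻¹))  ≈⟨ ∙-congˡ (AP.\\-leftDividesʳ y (z ⁻¹)) ⟩
    x ∙ z ⁻¹                 ∎
    where open SetoidReasoning setoid

  skew : ℕ → Carrier → Carrier
  skew k x = (F^ k) x ∙ (F⁻^ k) x ⁻¹

  skew-additive : ∀ k → IsAdditive A A (skew k)
  skew-additive k = additive-∙ (F^-additive k) (additive-⁻¹ (F⁻^-additive k))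

  F^-skew : ∀ k x → (F^ k) (skew k x) ≈ δ (k ℕ.* 2) x
  F^-skew k x = begin
    (F^ k) ((F^ k) x ∙ (F⁻^ k) x ⁻¹)           ≈⟨ IsAdditive.-‿homo (F^-additive k) _ _ ⟩
    (F^ k) ((F^ k) x) ∙ (F^ k) ((F⁻^ k) x) ⁻¹  ≈⟨ ∙-cong (reflexive (≡.sym (F^-double k x))) (⁻¹-cong (F^-F⁻^ k x)) ⟩
    δ (k ℕ.* 2) x                              ∎
    where open SetoidReasoning setoid

  -- F^k is invertible, so composing with it leaves the kernel unchanged. This clears the negative
  -- powers of `F` from `skew`.
  Ker-F^∘ : ∀ k {g h} {m} → (∀ x → (F^ k) (g x) ≈ h x) → HasSize (Ker A A h) m → HasSize (Ker A A g) m
  Ker-F^∘ k {g} {h} F^g≈h = size-⇔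
    (λ x hx≈ε → begin
      g x                     ≈⟨ F⁻^-F^ k (g x) ⟨
      (F⁻^ k) ((F^ k) (g x))  ≈⟨ IsAdditive.cong (F⁻^-additive k) (trans (F^g≈h x) hx≈ε) ⟩
      (F⁻^ k) ε               ≈⟨ IsAdditive.ε-homo (F⁻^-additive k) ⟩
      ε                       ∎)
    (λ x gx≈ε → begin
      h x           ≈⟨ F^g≈h x ⟨
      (F^ k) (g x)  ≈⟨ IsAdditive.cong (F^-additive k) gx≈ε ⟩
      (F^ k) ε      ≈⟨ IsAdditive.ε-homo (F^-additive k) ⟩
      ε             ∎)
    where open SetoidReasoning setoid

  σ : Carrier → Carrier
  σ x = F x ∙ x

  σ-additive : IsAdditive A A σ
  σ-additive = additive-∙ F-additive additive-id

  -- Multiplying F^(k+1) - F^(-k-1) + F^k - F^(-k) by F^(k+1) gives F^(2k+2) - 1 + F^(2k+1) - F,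
  -- which factors as (F^(2k+1) - 1)(F + 1).
  F^-skew+skew : ∀ k x → (F^ suc k) (skew (suc k) x ∙ skew k x) ≈ δ (suc (k ℕ.* 2)) (σ x)
  F^-skew+skew k x = begin
    (F^ suc k) (skew (suc k) x ∙ skew k x)
      ≈⟨ IsAdditive.homo (F^-additive (suc k)) _ _ ⟩
    (F^ suc k) (skew (suc k) x) ∙ F ((F^ k) (skew k x))
      ≈⟨ ∙-cong (F^-skew (suc k) x) (F-cong (F^-skew k x)) ⟩
    δ (suc k ℕ.* 2) x ∙ F (δ (k ℕ.* 2) x)
      ≈⟨ ∙-congˡ (IsAdditive.-‿homo F-additive _ _) ⟩
    -- The powers with exponents 2k + 2 and 2k + 1 are F y and `y` by computation.
    (F y ∙ x ⁻¹) ∙ (y ∙ F x ⁻¹)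
      ≈⟨ interchange commutativeSemigroup _ _ _ _ ⟩
    (F y ∙ y) ∙ (x ⁻¹ ∙ F x ⁻¹)
      ≈⟨ ∙-cong (∙-congʳ (reflexive (iter-comm F f x))) (AP.⁻¹-anti-homo-∙ (F x) x) ⟨
    ((F^ f) (F x) ∙ y) ∙ (σ x) ⁻¹
      ≈⟨ ∙-congʳ (IsAdditive.homo (F^-additive f) (F x) x) ⟨
    δ f (σ x) ∎
    where
    open SetoidReasoning setoid
    f = suc (k ℕ.* 2)
    y = (F^ f) x

  δ₁≈ε⇒δ≈ε : ∀ k x → δ 1 x ≈ ε → δ k x ≈ ε
  δ₁≈ε⇒δ≈ε k x δ₁x≈ε = AP.x≈y⇒x∙y⁻¹≈ε (F^-fixed k (AP.x∙y⁻¹≈ε⇒x≈y _ _ δ₁x≈ε))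

  δ₁-σ : ∀ x → δ 1 (σ x) ≈ δ 2 x
  δ₁-σ x = trans (IsAdditive.homo (δ-additive 1) (F x) x) (telescope (F (F x)) (F x) x)

  δ₂≈ε⇒δσ≈ε : ∀ k x → δ 2 x ≈ ε → δ k (σ x) ≈ ε
  δ₂≈ε⇒δσ≈ε k x δ₂x≈ε = δ₁≈ε⇒δ≈ε k (σ x) (trans (δ₁-σ x) δ₂x≈ε)

  -- The partial sum 1 + F² + ... + F^(2k-2) of the geometric series in F², which is the quotient of
  -- F^(2k) - 1 by F² - 1.
  geometric : ℕ → Carrier → Carrier
  geometric zero    x = ε
  geometric (suc k) x = x ∙ F (F (geometric k x))

  δ₂-geometric : ∀ k x → δ 2 (geometric k x) ≈ δ (k ℕ.* 2) x
  δ₂-geometric zero    x = trans (IsAdditive.ε-homo (δ-additive 2)) (sym (inverseʳ x))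
  δ₂-geometric (suc k) x = begin
    δ 2 (x ∙ F (F t))                       ≈⟨ IsAdditive.homo (δ-additive 2) x (F (F t)) ⟩
    δ 2 x ∙ δ 2 (F (F t))                   ≈⟨ ∙-congˡ (trans (δ-F 2 (F t)) (F-cong (δ-F 2 t))) ⟩
    δ 2 x ∙ F (F (δ 2 t))                   ≈⟨ ∙-congˡ (F-cong (F-cong (δ₂-geometric k x))) ⟩
    δ 2 x ∙ F (F (δ (k ℕ.* 2) x))           ≈⟨ ∙-congˡ (IsAdditive.-‿homo (F^-additive 2) ((F^ (k ℕ.* 2)) x) x) ⟩
    δ 2 x ∙ ((F^ (suc k ℕ.* 2)) x ∙ F (F x) ⁻¹)  ≈⟨ comm _ _ ⟩
    ((F^ (suc k ℕ.* 2)) x ∙ F (F x) ⁻¹) ∙ δ 2 x  ≈⟨ telescope _ _ _ ⟩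
    δ (suc k ℕ.* 2) x                       ∎
    where
    open SetoidReasoning setoid
    t = geometric k x

  -- `geometric k` is a polynomial in `F`, so it preserves the fixed subgroup of F^f.
  geometric-δ≈ε : ∀ f k x → δ f x ≈ ε → δ f (geometric k x) ≈ ε
  geometric-δ≈ε f zero    x δx≈ε = IsAdditive.ε-homo (δ-additive f)
  geometric-δ≈ε f (suc k) x δx≈ε = IsSubgroup.∙-closed (ker-isSubgroup A A (δ-additive f)) δx≈ε (begin
    δ f (F (F t))    ≈⟨ trans (δ-F f (F t)) (F-cong (δ-F f t)) ⟩
    F (F (δ f t))    ≈⟨ F-cong (F-cong (geometric-δ≈ε f k x δx≈ε)) ⟩
    F (F ε)          ≈⟨ IsAdditive.ε-homo (F^-additive 2) ⟩
    ε                ∎)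
    where
    open SetoidReasoning setoid
    t = geometric k x

  -- If F^(2k+1) x = x then (F − 1) x = − F (F^(2k) − 1) x, and F² − 1 divides F^(2k) − 1.
  F-1⇒F²-1 : ∀ k u → let f = suc (k ℕ.* 2) in
             (∃ λ x → δ f x ≈ ε × δ 1 x ≈ u) → ∃ λ x → δ f (σ x) ≈ ε × δ 2 x ≈ u
  F-1⇒F²-1 k u (x , δx≈ε , δ₁x≈u) = v , δσv≈ε , δ₂v≈u
    where
    open SetoidReasoning setoid
    f = suc (k ℕ.* 2)
    t = geometric k x
    v = F t ⁻¹
    δv≈ε : δ f v ≈ ε
    δv≈ε = IsSubgroup.⁻¹-closed (ker-isSubgroup A A (δ-additive f))
      (trans (δ-F f t) (trans (F-cong (geometric-δ≈ε f k x δx≈ε)) (IsAdditive.ε-homo F-additive)))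
    δσv≈ε : δ f (σ v) ≈ ε
    δσv≈ε = IsSubgroup.∙-closed (ker-isSubgroup A A (δ-additive f))
      (trans (δ-F f v) (trans (F-cong δv≈ε) (IsAdditive.ε-homo F-additive))) δv≈ε
    δ₂v≈u : δ 2 v ≈ u
    δ₂v≈u = begin
      δ 2 (F t ⁻¹)                    ≈⟨ IsAdditive.⁻¹-homo (δ-additive 2) (F t) ⟩
      δ 2 (F t) ⁻¹                    ≈⟨ ⁻¹-cong (trans (δ-F 2 t) (F-cong (δ₂-geometric k x))) ⟩
      F (δ (k ℕ.* 2) x) ⁻¹            ≈⟨ ⁻¹-cong (IsAdditive.-‿homo F-additive _ x) ⟩
      ((F^ f) x ∙ F x ⁻¹) ⁻¹          ≈⟨ ⁻¹-cong (∙-congʳ (AP.x∙y⁻¹≈ε⇒x≈y _ _ δx≈ε)) ⟩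
      (x ∙ F x ⁻¹) ⁻¹                 ≈⟨ AP.⁻¹-anti-homo-// x (F x) ⟩
      F x ∙ x ⁻¹                      ≈⟨ δ₁x≈u ⟩
      u                               ∎

  -- As F² - 1 = (F - 1)(F + 1), the element σ x is the new witness. With `F-1⇒F²-1` this makes the
  -- two images equal.
  F²-1⇒F-1 : ∀ f u → (∃ λ x → δ f (σ x) ≈ ε × δ 2 x ≈ u) → ∃ λ x → δ f x ≈ ε × δ 1 x ≈ u
  F²-1⇒F-1 f u (x , δσx≈ε , δ₂x≈u) = σ x , δσx≈ε , trans (δ₁-σ x) δ₂x≈u

-- Fixed points of powers of an isometry

module _ (A : AbelianGroup c ℓ) (V : AbelianGroup c′ ℓ′) where
  open AbelianGroup A
  private
    module V = AbelianGroup V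
    module AP = AbelianGroupProperties A
    module VP = AbelianGroupProperties V

  module IsometryForm {n : ℕ} (|A| : HasSize setoid n) {b : Carrier → Carrier → V.Carrier}
    (additiveˡ : ∀ y → IsAdditive A V (λ x → b x y))
    (symmetric : ∀ x y → b x y V.≈ b y x) (squares : HasSquareCofactors A V n b)
    (φ : Automorphism A) (invariant : ∀ x y → b (Automorphism.F φ x) (Automorphism.F φ y) V.≈ b x y) where
    open Automorphism φ
    open AutomorphismPowers φ
    private
      module E = Enumeration |A|
      instance
        n≢0 : NonZero n
        n≢0 = Fin.nonZeroIndex (E.index ε)

    F^-invariant : ∀ k x y → b ((F^ k) x) ((F^ k) y) V.≈ b x y
    F^-invariant zero    x y = V.refl
    F^-invariant (suc k) x y = V.trans (invariant _ _) (F^-invariant k x y)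

    -- The two terms agree: invariance gives b (F^(-k) x) x = b x (F^k x), which is b (F^k x) x by
    -- symmetry.
    skew-alternating : ∀ k x → b (skew k x) x V.≈ V.ε
    skew-alternating k x = V.trans (IsAdditive.-‿homo (additiveˡ x) _ _) (VP.x≈y⇒x∙y⁻¹≈ε (V.sym (begin
      b ((F⁻^ k) x) x                        ≈⟨ F^-invariant k _ _ ⟨
      b ((F^ k) ((F⁻^ k) x)) ((F^ k) x)      ≈⟨ IsAdditive.cong (additiveˡ ((F^ k) x)) (F^-F⁻^ k x) ⟩
      b x ((F^ k) x)                         ≈⟨ symmetric _ _ ⟩
      b ((F^ k) x) x                         ∎)))
      where open SetoidReasoning V.setoid

    even-power : ∀ k {m} → HasSize (Ker A A (δ (k ℕ.* 2))) m → ∃ λ j → n ≡ m ℕ.* (j ℕ.* j)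
    even-power k I = squares (skew-additive k) (skew-alternating k) (Ker-F^∘ k (F^-skew k) I)

    even-power∼ : ∀ k {m} → HasSize (Ker A A (δ (k ℕ.* 2))) m → m ∼ n
    even-power∼ k {m} I = let j , n≡ = even-power k I in square-cofactor⇒∼ n m j n≡

    -- A sum of two skew maps still satisfies b (g x) x = 0, and up to an invertible power of `F`
    -- the sum is (F^(2k+1) - 1)(F + 1).
    δσ-power : ∀ k {m} → HasSize (Ker A A (λ x → δ (suc (k ℕ.* 2)) (σ x))) m → ∃ λ j → n ≡ m ℕ.* (j ℕ.* j)
    δσ-power k I = squares (additive-∙ (skew-additive (suc k)) (skew-additive k))
      (λ x → V.trans (IsAdditive.homo (additiveˡ x) _ _)
        (V.trans (V.∙-cong (skew-alternating (suc k) x) (skew-alternating k x)) (V.identityˡ _)))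
      (Ker-F^∘ (suc k) (F^-skew+skew k) I)

    -- Let `d` be the order of the common image. Then m = m₁ d, while Ker (F² - 1) and Ker (F^f -
    -- 1)(F + 1) have orders `t` and t d. Both have square cofactors in `n`, so `d` is a rational
    -- square.
    odd-power∼ : ∀ k {m m₁} → HasSize (Ker A A (δ (suc (k ℕ.* 2)))) m → HasSize (Ker A A (δ 1)) m₁ → m ∼ m₁
    odd-power∼ k {m} {m₁} |δf| |δ1| =
      let t , |δ2| = subset-size |A| (λ eq → trans (IsAdditive.cong (δ-additive 2) (sym eq))) (λ x → δ 2 x E.≈? ε)
          -- The image is described inside `A` by a decidable predicate, so a single count can serve
          -- both homomorphisms.
          d , |D| = subset-size {P = λ u → ∃ λ x → δ f x ≈ ε × δ 1 x ≈ u} |A|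
            (λ u≈v → λ { (x , δx≈ε , δ₁x≈u) → x , δx≈ε , trans δ₁x≈u u≈v })
            (λ u → E.any? (λ x≈y → λ { (δx≈ε , δ₁x≈u) → trans (IsAdditive.cong (δ-additive f) (sym x≈y)) δx≈ε ,
                                                       trans (IsAdditive.cong (δ-additive 1) (sym x≈y)) δ₁x≈u })
                          (λ x → (δ f x E.≈? ε) ×-dec (δ 1 x E.≈? u)))
          |δf|′ : HasSize (Ker A A (δ f)) (m₁ ℕ.* d)
          |δf|′ = size-ker-im (subgroup A Kf) A (additive-∘ (δ-additive 1) (additive-proj₁ Kf))
            (size-transport (λ { (x , δ₁x≈ε) → (x , δ₁≈ε⇒δ≈ε f x δ₁x≈ε) , δ₁x≈ε })
              (λ eq → eq) (λ eq → eq) (λ { ((x , _) , δ₁x≈ε) → (x , δ₁x≈ε) , refl }) |δ1|)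
            (size-⇔ {S = setoid} (λ { u (x , δx≈ε , eq) → (x , δx≈ε) , eq })
                    (λ { u ((x , δx≈ε) , eq) → x , δx≈ε , eq }) |D|)
          |δσ| : HasSize (Ker A A (λ x → δ f (σ x))) (t ℕ.* d)
          |δσ| = size-ker-im (subgroup A Kσ) A (additive-∘ (δ-additive 2) (additive-proj₁ Kσ))
            (size-transport (λ { (x , δ₂x≈ε) → (x , δ₂≈ε⇒δσ≈ε f x δ₂x≈ε) , δ₂x≈ε })
              (λ eq → eq) (λ eq → eq) (λ { ((x , _) , δ₂x≈ε) → (x , δ₂x≈ε) , refl }) |δ2|)
            (size-⇔ {S = setoid} (λ u D → let x , δσx≈ε , eq = F-1⇒F²-1 k u D in (x , δσx≈ε) , eq)
                    (λ { u ((x , δσx≈ε) , eq) → F²-1⇒F-1 f u (x , δσx≈ε , eq) }) |D|)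
          j , n≡tjj = even-power 1 |δ2|
          l , n≡tdll = δσ-power k |δσ|
      in ≡.subst (_∼ m₁) (size-unique |δf|′ |δf|) (square-cofactors⇒∼ n t d m₁ j l n≡tjj n≡tdll)
      where
      f = suc (k ℕ.* 2)
      Kf = ker-isSubgroup A A (δ-additive f)
      Kσ = ker-isSubgroup A A (additive-∘ (δ-additive f) σ-additive)

-- Parity of exponents, twisted pairings and the two halves of the theorem

even-half : ∀ e → Evenℕ e → e ≡ e ℕ./ 2 ℕ.* 2
even-half e e-even = ≡.trans (m≡m%n+[m/n]*n e 2) (≡.cong (ℕ._+ e ℕ./ 2 ℕ.* 2) e-even)

odd-half : ∀ e → Oddℕ e → e ≡ suc (e ℕ./ 2 ℕ.* 2)
odd-half e e-odd = ≡.trans (m≡m%n+[m/n]*n e 2) (≡.cong (ℕ._+ e ℕ./ 2 ℕ.* 2) e-odd)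

module _ {A : AbelianGroup c ℓ} (P : Pairing A) {t : AbelianGroup.Carrier A → AbelianGroup.Carrier A}
         (t+ : IsAdditive A A t) where
  open AbelianGroup A
  open Pairing P renaming (cong to ⟨⟩-cong)
  open IsAdditive t+ using () renaming (cong to t-cong; homo to t-homo)
  open SetoidReasoning QZ.setoid

  precompose : Pairing A
  precompose = record
    { ⟨_,_⟩ = λ x y → ⟨ t x , y ⟩
    ; cong  = λ x≈x′ → ⟨⟩-cong (t-cong x≈x′)
    ; linˡ  = λ x x′ y → begin
        ⟨ t (x ∙ x′) , y ⟩               ≈⟨ ⟨⟩-cong (t-homo x x′) refl ⟩
        ⟨ t x ∙ t x′ , y ⟩               ≈⟨ linˡ (t x) (t x′) y ⟩
        ⟨ t x , y ⟩ ℚ.+ ⟨ t x′ , y ⟩     ∎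
    ; linʳ  = λ x → linʳ (t x)
    }

  -- Being its own inverse, `t` can be moved freely: on the left it is applied to the representing
  -- element, on the right a character is first composed with `t`.
  precompose-perfect : Perfect A P → (∀ x → t (t x) ≈ x) → Perfect A precompose
  precompose-perfect perfect involutive = record
    { injˡ  = λ x y eq → trans (sym (involutive x)) (trans (t-cong (injˡ (t x) (t y) eq)) (involutive y))
    ; surjˡ = λ ψ → let a , eq = surjˡ ψ in t a , λ x → begin
        ⟨ t (t a) , x ⟩     ≈⟨ ⟨⟩-cong (involutive a) refl ⟩
        ⟨ a , x ⟩           ≈⟨ eq x ⟩
        Character.χ ψ x     ∎
    ; injʳ  = λ a b eq → injʳ a b λ x → begin
        ⟨ x , a ⟩           ≈⟨ ⟨⟩-cong (involutive x) refl ⟨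
        ⟨ t (t x) , a ⟩     ≈⟨ eq (t x) ⟩
        ⟨ t (t x) , b ⟩     ≈⟨ ⟨⟩-cong (involutive x) refl ⟩
        ⟨ x , b ⟩           ∎
    ; surjʳ = λ ψ → let a , eq = surjʳ (ψ ∘t) in a , λ x → begin
        ⟨ t x , a ⟩              ≈⟨ eq (t x) ⟩
        Character.χ ψ (t (t x))  ≈⟨ Character.cong ψ (involutive x) ⟩
        Character.χ ψ x          ∎
    }
    where
    open Perfect perfect
    _∘t : Character A → Character A
    ψ ∘t = record
      { χ    = λ x → Character.χ ψ (t x)
      ; cong = λ x≈y → Character.cong ψ (t-cong x≈y)
      ; hom  = λ x y → begin
          Character.χ ψ (t (x ∙ y))                        ≈⟨ Character.cong ψ (t-homo x y) ⟩
          Character.χ ψ (t x ∙ t y)                        ≈⟨ Character.hom ψ (t x) (t y) ⟩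
          Character.χ ψ (t x) ℚ.+ Character.χ ψ (t y)      ∎
      }

theorem2p4p1 : ∀ {c ℓ} (A : AbelianGroup c ℓ) (n : ℕ) → HasSize (AbelianGroup.setoid A) n →
    ((P : Pairing A) → Perfect A P → Antisymmetric A P →
    (IsSquare n ⊎ IsTwiceSquare n)
    × (IsSquare n ⇔ (∃ λ (Q : Pairing A) → Perfect A Q × Alternating A Q))
    × (∀ (e m : ℕ) → e > 0 → HasSize (Torsion A e) m →
    (Evenℕ e → m ∼ n) × (Oddℕ e → m ∼ 1)))
    × ((F : Automorphism A) (P : Pairing A) → Perfect A P → SymmetricP A P → Invariant A F P →
    ∀ (f : ℤ) (m m₁ : ℕ) → HasSize (Fixed A F f) m → HasSize (Fixed A F (+ 1)) m₁ →
    (Oddℤ f → m ∼ m₁) × (Evenℤ f → m ∼ n))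
theorem2p4p1 A n |A| = antisymmetric , symmetric
  where
  open AbelianGroup A using (_≈_; ε)
  module A = AbelianGroup A
  module A× = Mult A.commutativeMonoid

  drop-1* : (∃ λ k → n ≡ 1 ℕ.* (k ℕ.* k)) → IsSquare n
  drop-1* (k , n≡) = k , ≡.trans n≡ (ℕ.*-identityˡ (k ℕ.* k))

  -- Take the identity for `g`; its kernel is trivial.
  alternating⇒square : (∃ λ (Q : Pairing A) → Perfect A Q × Alternating A Q) → IsSquare n
  alternating⇒square (Q , Q-perfect , Q-alternating) = drop-1*
    (square-cofactors Q |A| Q-perfect additive-id Q-alternating
      (size-bijection {m = 1} (λ _ → ε , A.refl) (λ { {zero} {zero} _ → ≡.refl })
        (λ { (x , x≈ε) → zero , A.sym x≈ε })))

  antisymmetric : (P : Pairing A) → Perfect A P → Antisymmetric A P →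
    (IsSquare n ⊎ IsTwiceSquare n)
    × (IsSquare n ⇔ (∃ λ (Q : Pairing A) → Perfect A Q × Alternating A Q))
    × (∀ (e m : ℕ) → e > 0 → HasSize (Torsion A e) m → (Evenℕ e → m ∼ n) × (Oddℕ e → m ∼ 1))
  antisymmetric P perfect antisym =
    dichotomy (q c₀ ≈QZ? 0ℚ) , mk⇔ (square⇒alternating (q c₀ ≈QZ? 0ℚ)) alternating⇒square , torsion
    where
    open AntisymmetricForm A QZ
    open Finite |A| (pairing-additiveˡ P) (pairing-additiveʳ P) antisym (square-cofactors P |A| perfect)
    -- Perfectness represents the diagonal character `q` by an element, and whether `q` vanishes
    -- there decides between square and twice a square.
    representative : ∃ λ c → ∀ x → Pairing.⟨_,_⟩ P c x ≈QZ q x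
    representative = Perfect.surjˡ perfect record
      { χ = q ; cong = IsAdditive.cong q-additive ; hom = IsAdditive.homo q-additive }
    c₀ = proj₁ representative
    -- The `refl` is the computation that ½ + ½ is an integer.
    open Twist _≈QZ?_ ½ ≡.refl 2-torsion (Perfect.injˡ perfect) c₀ (proj₂ representative)

    dichotomy : Dec (q c₀ ≈QZ 0ℚ) → IsSquare n ⊎ IsTwiceSquare n
    dichotomy (yes qc≈0) = inj₁ (drop-1* (square qc≈0))
    dichotomy (no  qc≉0) = inj₂ (twice-square qc≉0)

    square⇒alternating : Dec (q c₀ ≈QZ 0ℚ) → IsSquare n → ∃ λ (Q : Pairing A) → Perfect A Q × Alternating A Q
    square⇒alternating (yes qc≈0) _ =
      precompose P twist-additive ,
      precompose-perfect P twist-additive perfect (twist-involutive qc≈0) , twist-alternating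
    -- In this case n = 2k², so l² = 2k² would force k = 0, against the group being nonempty.
    square⇒alternating (no qc≉0) (l , n≡ll) = let k , n≡2kk = twice-square qc≉0 in
      contradiction (√2-irrational (<-wellFounded l) k (≡.trans (≡.sym n≡ll) n≡2kk))
        (ℕ.≢-nonZero⁻¹ k {{proj₂ (nonZero-factors n 2 k {{Fin.nonZeroIndex (Enumeration.index |A| ε)}} n≡2kk)}})

    torsion : ∀ (e m : ℕ) → e > 0 → HasSize (Torsion A e) m → (Evenℕ e → m ∼ n) × (Oddℕ e → m ∼ 1)
    torsion e m _ |A[e]| =
      (λ even → even-torsion∼ (e ℕ./ 2) (≡.subst (λ e → HasSize (Ker A A (e A×.×_)) m) (even-half e even) |ker|)) ,
      (λ odd → odd-torsion∼1 (e ℕ./ 2) (≡.subst (λ e → HasSize (Ker A A (e A×.×_)) m) (odd-half e odd) |ker|))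
      where
      |ker| : HasSize (Ker A A (e A×.×_)) m
      |ker| = Torsion⇒Ker e |A[e]|

  symmetric : (F : Automorphism A) (P : Pairing A) → Perfect A P → SymmetricP A P → Invariant A F P →
    ∀ (f : ℤ) (m m₁ : ℕ) → HasSize (Fixed A F f) m → HasSize (Fixed A F (+ 1)) m₁ →
    (Oddℤ f → m ∼ m₁) × (Evenℤ f → m ∼ n)
  symmetric F P perfect sym invariant f m m₁ |A^f| |A^1| =
    (λ odd → odd-power∼ (e ℕ./ 2) (≡.subst (λ e → HasSize (Ker A A (δ e)) m) (odd-half e odd) |ker|)
                         (Fixed⇒Ker-δ 1 |A^1|)) ,
    (λ even → even-power∼ (e ℕ./ 2) (≡.subst (λ e → HasSize (Ker A A (δ e)) m) (even-half e even) |ker|))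
    where
    open AutomorphismPowers F
    open IsometryForm A QZ |A| (pairing-additiveˡ P) sym (square-cofactors P |A| perfect) F invariant
    e = ℤ.∣ f ∣
    |ker| : HasSize (Ker A A (δ e)) m
    |ker| = Fixed⇒Ker-δ e (Fixed-abs f |A^f|)
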